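{- Let $m\geq 3$ be an integer, let $\alpha\in\mathbb{F}_{2^{m+1}}\setminus\{0\}$, and let $V_\alpha=\mathbb{F}_{2^{m+1}}\setminus\{0,\alpha\}$. Let $U_{\alpha,2}=\{\{i,j\}\subseteq V_\alpha : i+j=\alpha\}$ and, for $3\leq k\leq 2^m-4$, $$U_{\alpha,k}=\{B\subseteq V_\alpha : |B|=k,\ \textstyle\sum_{x\in B}x=\alpha,\ B\cap(B+\alpha)=\emptyset\},$$ where $B+\alpha=\{x+\alpha:x\in B\}$. Let $\lambda_k$ denote the number of $k$-subsets $B$ of $\mathbb{F}_{2^m}\setminus\{0\}$ with $\sum_{x\in B}x=0$ that contain a given pair of distinct elements of $\mathbb{F}_{2^m}\setminus\{0\}$ (this number is independent of the pair). Then for each $3\leq k\leq 2^m-4$, the triple $(V_\alpha,U_{\alpha,2},U_{\alpha,k})$ is a $(k,\lambda_k')$-GDD with $\lambda_k'=2^{k-3}\lambda_k$.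
   Context: $\mathbb{F}_{q}$ denotes the finite field with $q$ elements. For positive integers $k,\lambda$, a $(k,\lambda)$-GDD (group divisible design) is a triple $(X,\mathcal{G},\mathcal{B})$ where $X$ is a finite set, $\mathcal{G}$ is a partition of $X$ into parts called groups, and $\mathcal{B}$ is a family of subsets of $X$ called blocks, such that (i) every block has exactly $k$ elements, (ii) every pair of distinct elements of $X$ occurs either in exactly $\lambda$ blocks or in one group, but not both, and (iii) $|\mathcal{G}|>1$. -}

module Defs where

open import Data.Nat using (ℕ; zero; suc; _≡ᵇ_)
open import Data.Bool using (Bool; true; false; _∧_; not; if_then_else_)
open import Data.Fin using (Fin)
open import Data.Fin.Properties using () renaming (_≟_ to _≟ᶠ_)
open import Data.Fin.Subset using (Subset; inside; outside; _∈_; _∩_; _⊆_; ∣_∣; ⊥)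
open import Data.Fin.Subset.Properties using (_∈?_; _⊆?_)
open import Data.Vec.Properties using (≡-dec)
open import Data.Bool.Properties using () renaming (_≟_ to _≟ᵇ_)
open import Data.Nat.Properties using () renaming (_≟_ to _≟ⁿ_)
open import Relation.Nullary.Decidable using (_×-dec_)
open import Data.List using (List; []; _∷_; _++_; map; filter; length; foldr; allFin)
open import Data.Vec using (Vec; []; _∷_; tabulate; lookup)
open import Data.Product using (Σ; _×_; _,_; ∃)
open import Data.Sum using (_⊎_)
open import Relation.Nullary using (¬_; Dec; yes; no)
open import Relation.Nullary.Decidable using (⌊_⌋)
open import Relation.Unary using (Pred; Decidable)
open import Relation.Binary.PropositionalEquality using (_≡_; _≢_)
open import Algebra.Core using (Op₁; Op₂)
open import Algebra.Structures using (IsCommutativeRing)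
open import Level using (0ℓ)

-- A field whose underlying set is Fin q (any field with q elements is
-- isomorphic to one of these, so "a field F_q" = "a field structure on Fin q").

record FieldOn (q : ℕ) : Set where
  infixl 7 _*_
  infixl 6 _+_
  field
    _+_ : Op₂ (Fin q)
    _*_ : Op₂ (Fin q)
    -_  : Op₁ (Fin q)
    0#  : Fin q
    1#  : Fin q
    isCommutativeRing : IsCommutativeRing _≡_ _+_ _*_ -_ 0# 1#
    0≢1     : 0# ≢ 1#
    inverse : ∀ x → x ≢ 0# → ∃ λ y → x * y ≡ 1#

allSubsets : ∀ n → List (Subset n)
allSubsets zero    = [] ∷ []
allSubsets (suc n) = map (outside ∷_) (allSubsets n) ++ map (inside ∷_) (allSubsets n)

countSubsets : ∀ {n} {P : Pred (Subset n) 0ℓ} → Decidable P → ℕ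
countSubsets {n} P? = length (filter P? (allSubsets n))

module _ {n : ℕ} where

  blocksThrough : {B : Pred (Subset n) 0ℓ} → Decidable B → Fin n → Fin n → ℕ
  blocksThrough {B} B? x y =
    countSubsets {P = λ S → B S × x ∈ S × y ∈ S}
      (λ S → dec3 (B? S) (x ∈? S) (y ∈? S))
    where
    dec3 : ∀ {P Q R : Set} → Dec P → Dec Q → Dec R → Dec (P × Q × R)
    dec3 (yes p) (yes q) (yes r) = yes (p , q , r)
    dec3 (no ¬p) _ _ = no λ { (p , _) → ¬p p }
    dec3 (yes _) (no ¬q) _ = no λ { (_ , q , _) → ¬q q }
    dec3 (yes _) (yes _) (no ¬r) = no λ { (_ , _ , r) → ¬r r }

  record IsGDD (k λ' : ℕ) (X : Subset n)
               (G : Pred (Subset n) 0ℓ)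
               (B : Pred (Subset n) 0ℓ) (B? : Decidable B) : Set where
    field
      groups-⊆       : ∀ S → G S → S ⊆ X
      groups-nonempty : ∀ S → G S → ∃ λ x → x ∈ S
      groups-cover   : ∀ x → x ∈ X → ∃ λ S → G S × x ∈ S
      groups-disjoint : ∀ S T x → G S → G T → x ∈ S → x ∈ T → S ≡ T
      blocks-⊆    : ∀ S → B S → S ⊆ X
      blocks-size : ∀ S → B S → ∣ S ∣ ≡ k
      pairs : ∀ x y → x ∈ X → y ∈ X → x ≢ y →
              ((∃ λ S → G S × x ∈ S × y ∈ S) × blocksThrough B? x y ≡ 0)
            ⊎ ((¬ ∃ λ S → G S × x ∈ S × y ∈ S) × blocksThrough B? x y ≡ λ')
      several-groups : ∃ λ S → ∃ λ T → G S × G T × S ≢ T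

module Construction {q : ℕ} (F : FieldOn q) where
  open FieldOn F

  sumOf : Subset q → Fin q
  sumOf S = foldr (λ x acc → if ⌊ x ∈? S ⌋ then x + acc else acc) 0# (allFin q)

  translate : Subset q → Fin q → Subset q
  translate S α = tabulate λ y → lookup S (y + (- α))

  Vα : Fin q → Subset q
  Vα α = tabulate λ x → if ⌊ x ≟ᶠ 0# ⌋ then outside
                         else if ⌊ x ≟ᶠ α ⌋ then outside else inside

  nonzero : Subset q
  nonzero = tabulate λ x → if ⌊ x ≟ᶠ 0# ⌋ then outside else inside

  U2 : Fin q → Pred (Subset q) 0ℓ
  U2 α S = S ⊆ Vα α × ∣ S ∣ ≡ 2 × sumOf S ≡ α

  Uk : ℕ → Fin q → Pred (Subset q) 0ℓ
  Uk k α S = S ⊆ Vα α × ∣ S ∣ ≡ k × sumOf S ≡ α × S ∩ translate S α ≡ ⊥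

  ZeroSumK : ℕ → Pred (Subset q) 0ℓ
  ZeroSumK k S = S ⊆ nonzero × ∣ S ∣ ≡ k × sumOf S ≡ 0#

  Uk? : ∀ k α → Decidable (Uk k α)
  Uk? k α S = (S ⊆? Vα α) ×-dec (∣ S ∣ ≟ⁿ k) ×-dec (sumOf S ≟ᶠ α)
              ×-dec ≡-dec _≟ᵇ_ (S ∩ translate S α) ⊥

  ZeroSumK? : ∀ k → Decidable (ZeroSumK k)
  ZeroSumK? k S = (S ⊆? nonzero) ×-dec (∣ S ∣ ≟ⁿ k) ×-dec (sumOf S ≟ᶠ 0#)

  lambdaK : ℕ → Fin q → Fin q → ℕ
  lambdaK k a b = blocksThrough (ZeroSumK? k) a b

-- The additive group of a field of order 2 ^ (m + 1) is a Boolean group: otherwise x ↦ - x would pair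
-- off the nonzero elements and the order would be odd. So it is isomorphic to bit vectors under xor, by an
-- isomorphism sending the first basis vectors to α, x, y; this identifies it with Bool × F₂^m where
-- α = (1, 0) and x, y have first coordinate 0. A block S through x and y splits into the parts S₀, S₁ with
-- first coordinate 0 and 1. The conditions S ∩ (S + α) = ∅ and Σ S = α say exactly that C = S₀ ∪ S₁ is a
-- zero-sum k-subset of F₂^m ∖ {0} through the images of x and y, and that T = S₁ is an odd-size subset of
-- C minus those two points; each C has 2 ^ (k - 3) such T. The same isomorphism argument for F' identifies
-- the number of such C with λ_k at the pair (a, b). A pair with x + y = α lies in the group {x, x + α}
-- and in no block, since such a block would meet its own translate by α.

module Submission where

open import Defs
open import Level using (0ℓ)
open import Function using (_∘_)
open import Function.Bundles using (mk⇔)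
open import Data.Empty using (⊥-elim; ⊥)
open import Data.Product using (_×_; _,_; ∃; proj₁; proj₂; Σ)
open import Data.Sum using (_⊎_; inj₁; inj₂)
open import Data.Bool using (Bool; true; false; _xor_; if_then_else_; not; _∧_; _∨_; T)
import Data.Bool.Properties as Bool
open import Data.Nat using (ℕ; zero; suc; _+_; _*_; _^_; _<?_; _<_; _≤_; s≤s; z≤n; _≡ᵇ_; _∸_)
import Data.Nat.Properties as ℕ
open import Data.Fin using (Fin; zero; suc; toℕ; combine; remQuot; punchOut)
open import Data.Fin.Properties using (_≟_; suc-injective; toℕ-injective; remQuot-combine; combine-remQuot; any?; injective⇒≤; punchOut-injective)
open import Data.Fin.Subset using (Subset; inside; outside; ∣_∣; _∈_; _∩_; _⊆_) renaming (⊥ to ∅)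
open import Data.Fin.Subset.Properties using (_∈?_)
open import Data.Vec using (Vec; []; _∷_; _++_; lookup; tabulate; replicate; zipWith; splitAt)
open import Data.Vec.Properties using (lookup∘tabulate; tabulate∘lookup; tabulate-cong)
import Data.Vec.Properties as Vec
open import Data.List using (List; []; _∷_; map; foldr; filter; length; allFin)
import Data.List as L
open import Data.List.Properties using (map-tabulate; length-tabulate)
open import Algebra.Bundles using (CommutativeSemigroup; Group)
open import Algebra.Core using (Op₂)
import Algebra.Properties.CommutativeSemigroup as CommutativeSemigroupProperties
import Algebra.Properties.Group as GroupProperties
open import Algebra.Structures using (IsCommutativeMonoid; IsCommutativeRing)
open import Data.List.Membership.Propositional using (lose) renaming (_∈_ to _∈ₗ_)
open import Data.List.Membership.Propositional.Properties using (∈-map⁺; ∈-map⁻; ∈-++⁺ˡ; ∈-++⁺ʳ; ∈-allFin)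
open import Data.List.Membership.Propositional.Properties.WithK using (unique∧set⇒bag)
open import Data.List.Relation.Binary.BagAndSetEquality using (∼bag⇒↭)
open import Data.List.Relation.Binary.Permutation.Propositional using (_↭_; ↭⇒↭ₛ; ↭-sym)
import Data.List.Relation.Binary.Permutation.Propositional.Properties as ↭
import Data.List.Relation.Binary.Permutation.Setoid.Properties as ↭ₛ
import Data.List.Relation.Unary.All as All
import Data.List.Relation.Unary.AllPairs as AllPairs
open import Data.List.Relation.Unary.Any as Any using (here; there; satisfied)
open import Data.List.Relation.Unary.Unique.Propositional using (Unique)
import Data.List.Relation.Unary.Unique.Propositional.Properties as Unique
open import Relation.Binary.Definitions using (tri<; tri≈; tri>)
open import Relation.Binary.PropositionalEquality
open import Relation.Nullary using (Dec; yes; no; ¬_)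
open import Relation.Nullary.Decidable using (⌊_⌋; ¬?)
open import Relation.Unary using (Pred; Decidable)

unique⇒↭ : {A : Set} {xs ys : List A} → Unique xs → Unique ys →
  (∀ {z} → z ∈ₗ xs → z ∈ₗ ys) → (∀ {z} → z ∈ₗ ys → z ∈ₗ xs) → xs ↭ ys
unique⇒↭ u v f g = ∼bag⇒↭ (unique∧set⇒bag u v (mk⇔ f g))

module MonoidSum {A : Set} {_∙_ : Op₂ A} {ε : A} (isCM : IsCommutativeMonoid _≡_ _∙_ ε) where
  open IsCommutativeMonoid isCM using (assoc; identityˡ; identityʳ; isCommutativeSemigroup)

  private
    commutativeSemigroup : CommutativeSemigroup 0ℓ 0ℓ
    commutativeSemigroup = record { isCommutativeSemigroup = isCommutativeSemigroup }

  open CommutativeSemigroupProperties commutativeSemigroup public using (interchange)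

  sum : {B : Set} → (B → A) → List B → A
  sum f xs = foldr _∙_ ε (map f xs)

  sum-++ : {B : Set} (f : B → A) (xs ys : List B) → sum f (xs L.++ ys) ≡ sum f xs ∙ sum f ys
  sum-++ f []       ys = sym (identityˡ _)
  sum-++ f (x ∷ xs) ys = trans (cong (f x ∙_) (sum-++ f xs ys)) (sym (assoc _ _ _))

  sum-map : {B C : Set} (f : B → A) (g : C → B) (xs : List C) → sum f (map g xs) ≡ sum (f ∘ g) xs
  sum-map f g []       = refl
  sum-map f g (x ∷ xs) = cong (f (g x) ∙_) (sum-map f g xs)

  sum-cong : {B : Set} {f g : B → A} (xs : List B) → (∀ {x} → x ∈ₗ xs → f x ≡ g x) → sum f xs ≡ sum g xs
  sum-cong []       h = refl
  sum-cong (x ∷ xs) h = cong₂ _∙_ (h (here refl)) (sum-cong xs (h ∘ there))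

  sum-ε : {B : Set} (xs : List B) → sum (λ _ → ε) xs ≡ ε
  sum-ε []       = refl
  sum-ε (x ∷ xs) = trans (cong (ε ∙_) (sum-ε xs)) (identityˡ ε)

  sum-distrib : {B : Set} (f g : B → A) (xs : List B) → sum (λ x → f x ∙ g x) xs ≡ sum f xs ∙ sum g xs
  sum-distrib f g []       = sym (identityˡ ε)
  sum-distrib f g (x ∷ xs) = trans (cong ((f x ∙ g x) ∙_) (sum-distrib f g xs)) (interchange _ _ _ _)

  sum-↭ : {B : Set} (f : B → A) {xs ys : List B} → xs ↭ ys → sum f xs ≡ sum f ys
  sum-↭ f p = ↭ₛ.foldr-commMonoid (setoid _) isCM (↭⇒↭ₛ (↭.map⁺ f p))

  sum-allFin-suc : ∀ {n} (f : Fin (suc n) → A) → sum f (allFin (suc n)) ≡ f zero ∙ sum (f ∘ suc) (allFin n)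
  sum-allFin-suc {n} f = cong (f zero ∙_) (trans (cong (sum f) (sym (map-tabulate {n = n} (λ x → x) suc))) (sum-map f suc (allFin n)))

  sum-permute : {B : Set} {xs : List B} → Unique xs → (∀ b → b ∈ₗ xs) → (σ τ : B → B) →
    (∀ b → σ (τ b) ≡ b) → (∀ b → τ (σ b) ≡ b) → (f : B → A) → sum f xs ≡ sum (f ∘ σ) xs
  sum-permute {xs = xs} u complete σ τ στ τσ f = trans (sum-↭ f (↭-sym σxs↭xs)) (sum-map f σ xs)
    where
    σ-injective : ∀ {x y} → σ x ≡ σ y → x ≡ y
    σ-injective {x} {y} e = trans (sym (τσ x)) (trans (cong τ e) (τσ y))
    σxs↭xs : map σ xs ↭ xs
    σxs↭xs = unique⇒↭ (Unique.map⁺ σ-injective u) u (λ {z} _ → complete z)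
      (λ {z} _ → subst (_∈ₗ map σ xs) (στ z) (∈-map⁺ σ (complete (τ z))))

module SumHomomorphism {A A' : Set} {_∙_ : Op₂ A} {ε : A} {_∙'_ : Op₂ A'} {ε' : A'}
  (isCM : IsCommutativeMonoid _≡_ _∙_ ε) (isCM' : IsCommutativeMonoid _≡_ _∙'_ ε')
  (h : A → A') (h-ε : h ε ≡ ε') (h-∙ : ∀ a b → h (a ∙ b) ≡ h a ∙' h b) where
  open MonoidSum isCM using (sum)
  open MonoidSum isCM' using () renaming (sum to sum')

  sum-hom : {B : Set} (f : B → A) (xs : List B) → h (sum f xs) ≡ sum' (h ∘ f) xs
  sum-hom f []       = h-ε
  sum-hom f (x ∷ xs) = trans (h-∙ _ _) (cong (h (f x) ∙'_) (sum-hom f xs))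

open MonoidSum ℕ.+-0-isCommutativeMonoid public using () renaming
  (sum to Σℕ; sum-++ to Σℕ-++; sum-map to Σℕ-map; sum-cong to Σℕ-cong; sum-ε to Σℕ-0;
   sum-distrib to Σℕ-+; sum-allFin-suc to Σℕ-allFin-suc; sum-permute to Σℕ-permute)

Σℕ-* : {A : Set} (c : ℕ) (f : A → ℕ) (xs : List A) → Σℕ (λ x → c * f x) xs ≡ c * Σℕ f xs
Σℕ-* c f []       = sym (ℕ.*-zeroʳ c)
Σℕ-* c f (x ∷ xs) = trans (cong (c * f x +_) (Σℕ-* c f xs)) (sym (ℕ.*-distribˡ-+ c (f x) _))

𝟙 : Bool → ℕ
𝟙 true  = 1
𝟙 false = 0

𝟙-cong : {P Q : Set} (P? : Dec P) (Q? : Dec Q) → (P → Q) → (Q → P) → 𝟙 ⌊ P? ⌋ ≡ 𝟙 ⌊ Q? ⌋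
𝟙-cong (yes p) (yes q) f g = refl
𝟙-cong (yes p) (no ¬q) f g = ⊥-elim (¬q (f p))
𝟙-cong (no ¬p) (yes q) f g = ⊥-elim (¬p (g q))
𝟙-cong (no ¬p) (no ¬q) f g = refl

length-filter≡Σ𝟙 : {A : Set} {P : Pred A 0ℓ} (P? : Decidable P) (xs : List A) →
  length (filter P? xs) ≡ Σℕ (λ x → 𝟙 ⌊ P? x ⌋) xs
length-filter≡Σ𝟙 P? []       = refl
length-filter≡Σ𝟙 P? (x ∷ xs) with P? x
... | yes _ = cong suc (length-filter≡Σ𝟙 P? xs)
... | no  _ = length-filter≡Σ𝟙 P? xs

Σℕ-𝟙≟ : ∀ n (c : Fin n) → Σℕ (λ x → 𝟙 ⌊ x ≟ c ⌋) (allFin n) ≡ 1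
Σℕ-𝟙≟ (suc n) zero    = trans (Σℕ-allFin-suc {n} (λ x → 𝟙 ⌊ x ≟ zero ⌋)) (cong suc (trans (Σℕ-cong (allFin n) (λ _ → refl)) (Σℕ-0 (allFin n))))
Σℕ-𝟙≟ (suc n) (suc c) = trans (Σℕ-allFin-suc {n} (λ x → 𝟙 ⌊ x ≟ suc c ⌋))
  (trans (Σℕ-cong (allFin n) (λ {x} _ → 𝟙-cong (suc x ≟ suc c) (x ≟ c) suc-injective (cong suc))) (Σℕ-𝟙≟ n c))

∣∣≡Σ𝟙 : ∀ {n} (S : Subset n) → ∣ S ∣ ≡ Σℕ (𝟙 ∘ lookup S) (allFin n)
∣∣≡Σ𝟙 []          = refl
∣∣≡Σ𝟙 (b ∷ S) = trans (head b) (trans (cong (𝟙 b +_) (∣∣≡Σ𝟙 S)) (sym (Σℕ-allFin-suc (𝟙 ∘ lookup (b ∷ S)))))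
  where
  head : ∀ b → ∣ b ∷ S ∣ ≡ 𝟙 b + ∣ S ∣
  head false = refl
  head true  = refl

allSubsets-unique : ∀ n → Unique (allSubsets n)
allSubsets-unique zero    = All.[] AllPairs.∷ AllPairs.[]
allSubsets-unique (suc n) =
  Unique.++⁺ (Unique.map⁺ ∷-injective (allSubsets-unique n)) (Unique.map⁺ ∷-injective (allSubsets-unique n)) disjoint
  where
  ∷-injective : ∀ {a b : Bool} {S T : Subset n} → a ∷ S ≡ b ∷ T → S ≡ T
  ∷-injective refl = refl
  disjoint : ∀ {v} → ¬ (v ∈ₗ map (outside ∷_) (allSubsets n) × v ∈ₗ map (inside ∷_) (allSubsets n))
  disjoint (p , q) with ∈-map⁻ (outside ∷_) p | ∈-map⁻ (inside ∷_) q
  ... | _ , _ , refl | _ , _ , ()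

allSubsets-complete : ∀ {n} (S : Subset n) → S ∈ₗ allSubsets n
allSubsets-complete []                = here refl
allSubsets-complete {suc n} (false ∷ S) = ∈-++⁺ˡ (∈-map⁺ (outside ∷_) (allSubsets-complete S))
allSubsets-complete {suc n} (true ∷ S)  =
  ∈-++⁺ʳ (map (outside ∷_) (allSubsets n)) (∈-map⁺ (inside ∷_) (allSubsets-complete S))

ΣSubset : ∀ n → (Subset n → ℕ) → ℕ
ΣSubset n f = Σℕ f (allSubsets n)

ΣSubset-suc : ∀ n (f : Subset (suc n) → ℕ) →
  ΣSubset (suc n) f ≡ ΣSubset n (λ S → f (outside ∷ S)) + ΣSubset n (λ S → f (inside ∷ S))
ΣSubset-suc n f = trans (Σℕ-++ f (map (outside ∷_) (allSubsets n)) _)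
  (cong₂ _+_ (Σℕ-map f _ (allSubsets n)) (Σℕ-map f _ (allSubsets n)))

ΣSubset-cong : ∀ n {f g : Subset n → ℕ} → (∀ S → f S ≡ g S) → ΣSubset n f ≡ ΣSubset n g
ΣSubset-cong n h = Σℕ-cong (allSubsets n) (λ {x} _ → h x)

ΣSubset-++ : ∀ a b (f : Subset (a + b) → ℕ) → ΣSubset (a + b) f ≡ ΣSubset a (λ S → ΣSubset b (λ T → f (S ++ T)))
ΣSubset-++ zero    b f = sym (ℕ.+-identityʳ _)
ΣSubset-++ (suc a) b f = trans (ΣSubset-suc (a + b) f)
  (trans (cong₂ _+_ (ΣSubset-++ a b (f ∘ (outside ∷_))) (ΣSubset-++ a b (f ∘ (inside ∷_)))) (sym (ΣSubset-suc a _)))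

countSubsets≡ΣSubset : ∀ {n} {P : Pred (Subset n) 0ℓ} (P? : Decidable P) → countSubsets P? ≡ ΣSubset n (λ S → 𝟙 ⌊ P? S ⌋)
countSubsets≡ΣSubset {n} P? = length-filter≡Σ𝟙 P? (allSubsets n)

preimage : ∀ {n} → (Fin n → Fin n) → Subset n → Subset n
preimage τ S = tabulate (lookup S ∘ τ)

lookup-preimage : ∀ {n} (τ : Fin n → Fin n) S z → lookup (preimage τ S) z ≡ lookup S (τ z)
lookup-preimage τ S z = lookup∘tabulate (lookup S ∘ τ) z

preimage-inverse : ∀ {n} (σ τ : Fin n → Fin n) → (∀ z → σ (τ z) ≡ z) → ∀ S → preimage τ (preimage σ S) ≡ S
preimage-inverse σ τ στ S =
  trans (tabulate-cong (λ z → trans (lookup-preimage σ S (τ z)) (cong (lookup S) (στ z)))) (tabulate∘lookup S)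

ΣSubset-preimage : ∀ n (σ τ : Fin n → Fin n) → (∀ z → σ (τ z) ≡ z) → (∀ z → τ (σ z) ≡ z) →
  (f : Subset n → ℕ) → ΣSubset n f ≡ ΣSubset n (f ∘ preimage τ)
ΣSubset-preimage n σ τ στ τσ =
  Σℕ-permute (allSubsets-unique n) allSubsets-complete (preimage τ) (preimage σ) (preimage-inverse σ τ στ) (preimage-inverse τ σ τσ)

∣preimage∣ : ∀ {n} (σ τ : Fin n → Fin n) → (∀ z → σ (τ z) ≡ z) → (∀ z → τ (σ z) ≡ z) →
  ∀ S → ∣ preimage τ S ∣ ≡ ∣ S ∣
∣preimage∣ {n} σ τ στ τσ S = begin
  ∣ preimage τ S ∣                                  ≡⟨ ∣∣≡Σ𝟙 (preimage τ S) ⟩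
  Σℕ (𝟙 ∘ lookup (preimage τ S)) (allFin n)         ≡⟨ Σℕ-permute (Unique.allFin⁺ n) ∈-allFin σ τ στ τσ _ ⟩
  Σℕ (𝟙 ∘ lookup (preimage τ S) ∘ σ) (allFin n)     ≡⟨ Σℕ-cong (allFin n) (λ {x} _ → cong 𝟙 (trans (lookup-preimage τ S (σ x)) (cong (lookup S) (τσ x)))) ⟩
  Σℕ (𝟙 ∘ lookup S) (allFin n)                      ≡⟨ ∣∣≡Σ𝟙 S ⟨
  ∣ S ∣                                             ∎
  where open ≡-Reasoning

-- ι swaps the x with toℕ x < toℕ (ι x) and those with toℕ (ι x) < toℕ x, so only fixed points are unpaired.
module Involution {q : ℕ} (ι : Fin q → Fin q) (ι-involutive : ∀ x → ι (ι x) ≡ x) where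

  below above onDiagonal : Fin q → ℕ
  below      x = 𝟙 ⌊ toℕ x <? toℕ (ι x) ⌋
  above      x = 𝟙 ⌊ toℕ (ι x) <? toℕ x ⌋
  onDiagonal x = 𝟙 ⌊ x ≟ ι x ⌋

  trichotomy : ∀ x → below x + above x + onDiagonal x ≡ 1
  trichotomy x with ℕ.<-cmp (toℕ x) (toℕ (ι x)) | toℕ x <? toℕ (ι x) | toℕ (ι x) <? toℕ x | x ≟ ι x
  ... | tri< _ _ _  | yes _ | no _  | no _  = refl
  ... | tri≈ _ e _  | no _  | no _  | yes _ = refl
  ... | tri> _ _ _  | no _  | yes _ | no _  = refl
  ... | tri< a _ _  | no ¬a | _     | _     = ⊥-elim (¬a a)
  ... | tri< _ _ c̸  | yes _ | yes c | _     = ⊥-elim (c̸ c)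
  ... | tri< _ ¬e _ | yes _ | no _  | yes e = ⊥-elim (¬e (cong toℕ e))
  ... | tri≈ ¬a _ _ | yes a | _     | _     = ⊥-elim (¬a a)
  ... | tri≈ _ _ ¬c | no _  | yes c | _     = ⊥-elim (¬c c)
  ... | tri≈ _ e _  | no _  | no _  | no ¬e = ⊥-elim (¬e (toℕ-injective e))
  ... | tri> ¬a _ _ | yes a | _     | _     = ⊥-elim (¬a a)
  ... | tri> _ _ c  | no _  | no ¬c | _     = ⊥-elim (¬c c)
  ... | tri> _ ¬e _ | no _  | yes _ | yes e = ⊥-elim (¬e (cong toℕ e))

  Σbelow≡Σabove : Σℕ below (allFin q) ≡ Σℕ above (allFin q)
  Σbelow≡Σabove = trans (Σℕ-permute (Unique.allFin⁺ q) ∈-allFin ι ι ι-involutive ι-involutive below)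
    (Σℕ-cong (allFin q) (λ {x} _ → cong (λ z → 𝟙 ⌊ toℕ (ι x) <? toℕ z ⌋) (ι-involutive x)))

  odd-if-unique-fixpoint : (c : Fin q) → c ≡ ι c → (∀ x → x ≡ ι x → x ≡ c) → ∃ λ a → q ≡ suc (a + a)
  odd-if-unique-fixpoint c c-fixed unique = B , sym (begin
    suc (B + B)                                 ≡⟨ cong (λ z → suc (B + z)) Σbelow≡Σabove ⟩
    suc (B + A)                                 ≡⟨ ℕ.+-comm 1 _ ⟩
    B + A + 1                                   ≡⟨ cong (B + A +_) (sym (trans Σdiagonal (Σℕ-𝟙≟ q c))) ⟩
    B + A + Σℕ onDiagonal (allFin q)            ≡⟨ cong (_+ Σℕ onDiagonal (allFin q)) (Σℕ-+ below above (allFin q)) ⟨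
    Σℕ (λ x → below x + above x) (allFin q) + Σℕ onDiagonal (allFin q)
                                                ≡⟨ Σℕ-+ (λ x → below x + above x) onDiagonal (allFin q) ⟨
    Σℕ (λ x → below x + above x + onDiagonal x) (allFin q)
                                                ≡⟨ Σℕ-cong (allFin q) (λ {x} _ → trichotomy x) ⟩
    Σℕ (λ _ → 1) (allFin q)                     ≡⟨ Σℕ-1 (allFin q) ⟩
    length (allFin q)                           ≡⟨ length-tabulate {n = q} (λ x → x) ⟩
    q                                           ∎)
    where
    open ≡-Reasoning
    B A : ℕ
    B = Σℕ below (allFin q)
    A = Σℕ above (allFin q)
    Σdiagonal : Σℕ onDiagonal (allFin q) ≡ Σℕ (λ x → 𝟙 ⌊ x ≟ c ⌋) (allFin q)
    Σdiagonal = Σℕ-cong (allFin q) (λ {x} _ → 𝟙-cong (x ≟ ι x) (x ≟ c) (unique x) (λ { refl → c-fixed }))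
    Σℕ-1 : ∀ {A : Set} (xs : List A) → Σℕ (λ _ → 1) xs ≡ length xs
    Σℕ-1 []       = refl
    Σℕ-1 (x ∷ xs) = cong suc (Σℕ-1 xs)

module CharacteristicTwo {q n : ℕ} (F : FieldOn q) (order : q ≡ 2 ^ suc n) where
  open FieldOn F renaming (_+_ to _⊞_; _*_ to _⊠_)
  open IsCommutativeRing isCommutativeRing
    using (+-isGroup; distribʳ; *-identityˡ; *-comm; *-assoc; zeroˡ; zeroʳ; -‿inverseʳ)

  private
    +-group : Group 0ℓ 0ℓ
    +-group = record { isGroup = +-isGroup }

  open GroupProperties +-group using (inverseʳ-unique; ⁻¹-involutive; ε⁻¹≈ε)

  [1+1]*x≡x+x : ∀ x → (1# ⊞ 1#) ⊠ x ≡ x ⊞ x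
  [1+1]*x≡x+x x = trans (distribʳ x 1# 1#) (cong₂ _⊞_ (*-identityˡ x) (*-identityˡ x))

  self-negative⇒0 : 1# ⊞ 1# ≢ 0# → ∀ x → x ≡ - x → x ≡ 0#
  self-negative⇒0 1+1≢0 x x≡-x with inverse (1# ⊞ 1#) 1+1≢0
  ... | y , 2y≡1 = begin
    x                     ≡⟨ *-identityˡ x ⟨
    1# ⊠ x                ≡⟨ cong (_⊠ x) (trans (*-comm y _) 2y≡1) ⟨
    y ⊠ (1# ⊞ 1#) ⊠ x     ≡⟨ *-assoc y _ x ⟩
    y ⊠ ((1# ⊞ 1#) ⊠ x)   ≡⟨ cong (y ⊠_) (trans ([1+1]*x≡x+x x) (trans (cong (x ⊞_) x≡-x) (-‿inverseʳ x))) ⟩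
    y ⊠ 0#                ≡⟨ zeroʳ y ⟩
    0#                    ∎
    where open ≡-Reasoning

  1+1≡0 : 1# ⊞ 1# ≡ 0#
  1+1≡0 with (1# ⊞ 1#) ≟ 0#
  ... | yes 1+1≡0 = 1+1≡0
  ... | no 1+1≢0 with Involution.odd-if-unique-fixpoint -_ ⁻¹-involutive 0# (sym ε⁻¹≈ε) (self-negative⇒0 1+1≢0)
  ... | a , q≡odd = ⊥-elim (ℕ.even≢odd (2 ^ n) a (trans (sym order) (trans q≡odd (cong (λ b → suc (a + b)) (sym (ℕ.+-identityʳ a))))))

  x+x≡0 : ∀ x → x ⊞ x ≡ 0#
  x+x≡0 x = trans (sym ([1+1]*x≡x+x x)) (trans (cong (_⊠ x) 1+1≡0) (zeroˡ x))

  -x≡x : ∀ x → - x ≡ x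
  -x≡x x = sym (inverseʳ-unique x x (x+x≡0 x))

-- Boolean groups; the model Bits n is Fin (2 ^ n), read as bit vectors via combine/remQuot, under xor

record BooleanGroup (N : ℕ) : Set where
  infixl 6 _⊕_
  field
    _⊕_                 : Op₂ (Fin N)
    0ᴮ                  : Fin N
    isCommutativeMonoid : IsCommutativeMonoid _≡_ _⊕_ 0ᴮ
    x⊕x≡0ᴮ              : ∀ x → x ⊕ x ≡ 0ᴮ

  open IsCommutativeMonoid isCommutativeMonoid public using (assoc; comm; identityˡ; identityʳ)
  open MonoidSum isCommutativeMonoid public

  x⊕[x⊕y]≡y : ∀ x y → x ⊕ (x ⊕ y) ≡ y
  x⊕[x⊕y]≡y x y = trans (sym (assoc x x y)) (trans (cong (_⊕ y) (x⊕x≡0ᴮ x)) (identityˡ y))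

  ⊕-cancelˡ : ∀ x y z → x ⊕ y ≡ x ⊕ z → y ≡ z
  ⊕-cancelˡ x y z e = trans (sym (x⊕[x⊕y]≡y x y)) (trans (cong (x ⊕_) e) (x⊕[x⊕y]≡y x z))

  x⊕y≡0ᴮ⇒x≡y : ∀ x y → x ⊕ y ≡ 0ᴮ → x ≡ y
  x⊕y≡0ᴮ⇒x≡y x y e = ⊕-cancelˡ y x y (trans (comm y x) (trans e (sym (x⊕x≡0ᴮ y))))

  Σᴮ : Subset N → Fin N
  Σᴮ S = sum (λ x → if lookup S x then x else 0ᴮ) (allFin N)

additiveBooleanGroup : ∀ {q n} (F : FieldOn q) → q ≡ 2 ^ suc n → BooleanGroup q
additiveBooleanGroup {n = n} F order = record
  { _⊕_ = FieldOn._+_ F ; 0ᴮ = FieldOn.0# F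
  ; isCommutativeMonoid = IsCommutativeRing.+-isCommutativeMonoid (FieldOn.isCommutativeRing F)
  ; x⊕x≡0ᴮ = CharacteristicTwo.x+x≡0 {n = n} F order }

bit : Fin 2 → Bool
bit zero    = false
bit (suc _) = true

unbit : Bool → Fin 2
unbit false = zero
unbit true  = suc zero

bit-unbit : ∀ b → bit (unbit b) ≡ b
bit-unbit false = refl
bit-unbit true  = refl

unbit-bit : ∀ i → unbit (bit i) ≡ i
unbit-bit zero       = refl
unbit-bit (suc zero) = refl

fromBits : ∀ n → Vec Bool n → Fin (2 ^ n)
fromBits zero    []      = zero
fromBits (suc n) (b ∷ v) = combine (unbit b) (fromBits n v)

toBits : ∀ n → Fin (2 ^ n) → Vec Bool n
bits : ∀ n → Fin 2 × Fin (2 ^ n) → Vec Bool (suc n)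
toBits zero    _ = []
toBits (suc n) x = bits n (remQuot {2} (2 ^ n) x)
bits n (i , r) = bit i ∷ toBits n r

toBits-fromBits : ∀ n v → toBits n (fromBits n v) ≡ v
toBits-fromBits zero    []      = refl
toBits-fromBits (suc n) (b ∷ v) = trans (cong (bits n) (remQuot-combine {2} {2 ^ n} (unbit b) (fromBits n v)))
  (cong₂ _∷_ (bit-unbit b) (toBits-fromBits n v))

fromBits-toBits : ∀ n x → fromBits n (toBits n x) ≡ x
fromBits-toBits zero    zero = refl
fromBits-toBits (suc n) x    = trans (cong₂ combine (unbit-bit i) (fromBits-toBits n r)) (combine-remQuot {2} (2 ^ n) x)
  where
  i : Fin 2
  i = proj₁ (remQuot {2} (2 ^ n) x)
  r : Fin (2 ^ n)
  r = proj₂ (remQuot {2} (2 ^ n) x)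

fromBits-injective : ∀ n {v w} → fromBits n v ≡ fromBits n w → v ≡ w
fromBits-injective n {v} {w} e = trans (sym (toBits-fromBits n v)) (trans (cong (toBits n) e) (toBits-fromBits n w))

zeros : ∀ n → Vec Bool n
zeros n = replicate n false

zeros-++ : ∀ a b → zeros a ++ zeros b ≡ zeros (a + b)
zeros-++ zero    b = refl
zeros-++ (suc a) b = cong (false ∷_) (zeros-++ a b)

_⊻_ : ∀ {n} → Op₂ (Vec Bool n)
_⊻_ = zipWith _xor_

⊻-self : ∀ {n} (v : Vec Bool n) → v ⊻ v ≡ zeros n
⊻-self []      = refl
⊻-self (b ∷ v) = cong₂ _∷_ (Bool.xor-same b) (⊻-self v)

⊻-isCommutativeMonoid : ∀ n → IsCommutativeMonoid _≡_ (_⊻_ {n}) (zeros n)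
⊻-isCommutativeMonoid n = record
  { isMonoid = record
    { isSemigroup = record
      { isMagma = record { isEquivalence = isEquivalence ; ∙-cong = cong₂ _⊻_ }
      ; assoc = Vec.zipWith-assoc Bool.xor-assoc }
    ; identity = Vec.zipWith-identityˡ Bool.xor-identityˡ , Vec.zipWith-identityʳ Bool.xor-identityʳ }
  ; comm = Vec.zipWith-comm Bool.xor-comm }

⊻-cancelʳ : ∀ {n} (C T : Vec Bool n) → (C ⊻ T) ⊻ T ≡ C
⊻-cancelʳ {n} C T = trans (assoc C T T) (trans (cong (C ⊻_) (⊻-self T)) (identityʳ C))
  where open IsCommutativeMonoid (⊻-isCommutativeMonoid n) using (assoc; identityʳ)

module _ (n : ℕ) where
  private
    open IsCommutativeMonoid (⊻-isCommutativeMonoid n) using () renaming (assoc to ⊻-assoc; comm to ⊻-comm; identityˡ to ⊻-identityˡ)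
    to : Fin (2 ^ n) → Vec Bool n
    to = toBits n
    from : Vec Bool n → Fin (2 ^ n)
    from = fromBits n

  _⊕ᵇ_ : Op₂ (Fin (2 ^ n))
  x ⊕ᵇ y = from (to x ⊻ to y)

  ⊕ᵇ-isCommutativeMonoid : IsCommutativeMonoid _≡_ _⊕ᵇ_ (from (zeros n))
  ⊕ᵇ-isCommutativeMonoid = record
    { isMonoid = record
      { isSemigroup = record
        { isMagma = record { isEquivalence = isEquivalence ; ∙-cong = cong₂ _⊕ᵇ_ }
        ; assoc = λ x y z → cong from (trans (cong (_⊻ to z) (toBits-fromBits n _))
                                      (trans (⊻-assoc _ _ _) (cong (to x ⊻_) (sym (toBits-fromBits n _))))) }
      ; identity = identityˡ , λ x → trans (cong from (⊻-comm (to x) _)) (identityˡ x) }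
    ; comm = λ x y → cong from (⊻-comm (to x) (to y)) }
    where
    identityˡ : ∀ x → from (zeros n) ⊕ᵇ x ≡ x
    identityˡ x = trans (cong from (trans (cong (_⊻ to x) (toBits-fromBits n _)) (⊻-identityˡ (to x)))) (fromBits-toBits n x)

  Bits : BooleanGroup (2 ^ n)
  Bits = record
    { _⊕_ = _⊕ᵇ_ ; 0ᴮ = from (zeros n) ; isCommutativeMonoid = ⊕ᵇ-isCommutativeMonoid
    ; x⊕x≡0ᴮ = λ x → cong from (⊻-self (to x)) }

injective⇒inverse : ∀ {n} (f : Fin n → Fin n) → (∀ {x y} → f x ≡ f y → x ≡ y) →
  Σ (Fin n → Fin n) λ g → (∀ y → f (g y) ≡ y) × (∀ x → g (f x) ≡ x)
injective⇒inverse {n} f f-injective = g , f∘g , (λ x → f-injective (f∘g (f x)))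
  where
  missed-value-impossible : ∀ {n} (y : Fin n) (f : Fin n → Fin n) → (∀ {x y} → f x ≡ f y → x ≡ y) → (∀ x → f x ≢ y) → ⊥
  missed-value-impossible {suc n} y f f-injective f≢y = ℕ.<-irrefl refl
    (injective⇒≤ {f = λ x → punchOut (f≢y x ∘ sym)}
      (λ {x} {x'} e → f-injective (punchOut-injective (f≢y x ∘ sym) (f≢y x' ∘ sym) e)))
  preimage-of : ∀ y → ∃ λ x → f x ≡ y
  preimage-of y with any? (λ x → f x ≟ y)
  ... | yes p  = p
  ... | no  ¬p = ⊥-elim (missed-value-impossible y f f-injective (λ x e → ¬p (x , e)))
  g : Fin n → Fin n
  g y = proj₁ (preimage-of y)
  f∘g : ∀ y → f (g y) ≡ y
  f∘g y = proj₂ (preimage-of y)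

module Linear {N : ℕ} (G : BooleanGroup N) where
  open BooleanGroup G

  scale : Bool → Fin N → Fin N
  scale b w = if b then w else 0ᴮ

  lincomb : ∀ {j} → Vec (Fin N) j → Vec Bool j → Fin N
  lincomb []       []       = 0ᴮ
  lincomb (w ∷ ws) (b ∷ bs) = scale b w ⊕ lincomb ws bs

  Independent : ∀ {j} → Vec (Fin N) j → Set
  Independent {j} ws = ∀ bs → lincomb ws bs ≡ 0ᴮ → bs ≡ zeros j

  lincomb-zeros : ∀ {j} (ws : Vec (Fin N) j) → lincomb ws (zeros j) ≡ 0ᴮ
  lincomb-zeros []       = refl
  lincomb-zeros (w ∷ ws) = trans (identityˡ _) (lincomb-zeros ws)

  scale-xor : ∀ a b w → scale (a xor b) w ≡ scale a w ⊕ scale b w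
  scale-xor false false w = sym (identityˡ 0ᴮ)
  scale-xor false true  w = sym (identityˡ w)
  scale-xor true  false w = sym (identityʳ w)
  scale-xor true  true  w = sym (x⊕x≡0ᴮ w)

  lincomb-⊻ : ∀ {j} (ws : Vec (Fin N) j) bs cs → lincomb ws (bs ⊻ cs) ≡ lincomb ws bs ⊕ lincomb ws cs
  lincomb-⊻ []       []       []       = sym (identityˡ 0ᴮ)
  lincomb-⊻ (w ∷ ws) (b ∷ bs) (c ∷ cs) =
    trans (cong₂ _⊕_ (scale-xor b c w) (lincomb-⊻ ws bs cs)) (interchange _ _ _ _)

  lincomb-++ : ∀ {j d} (ws : Vec (Fin N) j) (us : Vec (Fin N) d) bs cs →
    lincomb (ws ++ us) (bs ++ cs) ≡ lincomb ws bs ⊕ lincomb us cs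
  lincomb-++ []       us []       cs = sym (identityˡ _)
  lincomb-++ (w ∷ ws) us (b ∷ bs) cs = trans (cong (scale b w ⊕_) (lincomb-++ ws us bs cs)) (sym (assoc _ _ _))

  independent⇒lincomb-injective : ∀ {j} (ws : Vec (Fin N) j) → Independent ws →
    ∀ {bs cs} → lincomb ws bs ≡ lincomb ws cs → bs ≡ cs
  independent⇒lincomb-injective ws independent {bs} {cs} e =
    ⊻≡zeros⇒≡ bs cs (independent _ (trans (lincomb-⊻ ws bs cs) (trans (cong (_⊕ lincomb ws cs) e) (x⊕x≡0ᴮ _))))
    where
    ⊻≡zeros⇒≡ : ∀ {n} (v w : Vec Bool n) → v ⊻ w ≡ zeros n → v ≡ w
    ⊻≡zeros⇒≡ []          []          e = refl
    ⊻≡zeros⇒≡ (false ∷ v) (false ∷ w) e = cong (false ∷_) (⊻≡zeros⇒≡ v w (Vec.∷-injectiveʳ e))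
    ⊻≡zeros⇒≡ (true ∷ v)  (true ∷ w)  e = cong (true ∷_) (⊻≡zeros⇒≡ v w (Vec.∷-injectiveʳ e))
    ⊻≡zeros⇒≡ (false ∷ v) (true ∷ w)  ()
    ⊻≡zeros⇒≡ (true ∷ v)  (false ∷ w) ()

  independent-∷ : ∀ {j} (ws : Vec (Fin N) j) g → Independent ws → (∀ bs → lincomb ws bs ≢ g) → Independent (g ∷ ws)
  independent-∷ ws g independent g∉span (false ∷ bs) e = cong (false ∷_) (independent bs (trans (sym (identityˡ _)) e))
  independent-∷ ws g independent g∉span (true ∷ bs)  e = ⊥-elim (g∉span bs (sym (x⊕y≡0ᴮ⇒x≡y g _ e)))

  independent-swap : ∀ {j d} (ws : Vec (Fin N) j) (us : Vec (Fin N) d) → Independent (us ++ ws) → Independent (ws ++ us)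
  independent-swap {j} {d} ws us independent v e with splitAt j v
  ... | bs , cs , refl with independent (cs ++ bs) (trans (lincomb-++ us ws cs bs) (trans (comm _ _) (trans (sym (lincomb-++ ws us bs cs)) e)))
  ... | cs++bs≡0 = trans (cong₂ _++_ (Vec.++-injectiveʳ cs (zeros d) cs++bs≡0') (Vec.++-injectiveˡ cs (zeros d) cs++bs≡0')) (zeros-++ j d)
    where
    cs++bs≡0' : cs ++ bs ≡ zeros d ++ zeros j
    cs++bs≡0' = trans cs++bs≡0 (sym (zeros-++ d j))

  independent-[] : Independent []
  independent-[] [] _ = refl

  lincomb₂ : ∀ w v b c → lincomb (w ∷ v ∷ []) (b ∷ c ∷ []) ≡ scale b w ⊕ scale c v
  lincomb₂ w v b c = cong (scale b w ⊕_) (identityʳ _)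

  ∉span₀ : ∀ g → g ≢ 0ᴮ → ∀ bs → lincomb [] bs ≢ g
  ∉span₀ g g≢0 [] e = g≢0 (sym e)

  ∉span₁ : ∀ w g → g ≢ 0ᴮ → g ≢ w → ∀ bs → lincomb (w ∷ []) bs ≢ g
  ∉span₁ w g g≢0 g≢w (false ∷ []) e = g≢0 (trans (sym e) (identityˡ 0ᴮ))
  ∉span₁ w g g≢0 g≢w (true ∷ [])  e = g≢w (trans (sym e) (identityʳ w))

  ∉span₂ : ∀ w v g → g ≢ 0ᴮ → g ≢ w → g ≢ v → g ≢ w ⊕ v → ∀ bs → lincomb (w ∷ v ∷ []) bs ≢ g
  ∉span₂ w v g g≢0 g≢w g≢v g≢w⊕v (b ∷ c ∷ []) e with b | c | trans (sym e) (lincomb₂ w v b c)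
  ... | false | false | g≡ = g≢0 (trans g≡ (identityˡ 0ᴮ))
  ... | false | true  | g≡ = g≢v (trans g≡ (identityˡ v))
  ... | true  | false | g≡ = g≢w (trans g≡ (identityʳ w))
  ... | true  | true  | g≡ = g≢w⊕v g≡

module Extension (n : ℕ) (G : BooleanGroup (2 ^ n)) where
  open BooleanGroup G
  open Linear G

  -- If every element had coefficients over ws, reading them off would inject Fin (2 ^ n) into Fin (2 ^ j).
  outside-span : ∀ {j} (ws : Vec (Fin (2 ^ n)) j) → j < n → ∃ λ g → ∀ bs → lincomb ws bs ≢ g
  outside-span {j} ws j<n with any? (λ g → ¬? (Any.any? (λ bs → lincomb ws bs ≟ g) (allSubsets j)))
  ... | yes (g , g∉span) = g , λ bs e → g∉span (lose (allSubsets-complete bs) e)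
  ... | no  ¬g∉span     = ⊥-elim (ℕ.<⇒≱ (ℕ.^-monoʳ-< 2 (s≤s (s≤s z≤n)) j<n) (injective⇒≤ {f = code} code-injective))
    where
    coefficients : ∀ g → ∃ λ bs → lincomb ws bs ≡ g
    coefficients g with Any.any? (λ bs → lincomb ws bs ≟ g) (allSubsets j)
    ... | yes g∈span = satisfied g∈span
    ... | no  g∉span = ⊥-elim (¬g∉span (g , g∉span))
    code : Fin (2 ^ n) → Fin (2 ^ j)
    code g = fromBits j (proj₁ (coefficients g))
    code-injective : ∀ {x y} → code x ≡ code y → x ≡ y
    code-injective {x} {y} e = trans (sym (proj₂ (coefficients x)))
      (trans (cong (lincomb ws) (fromBits-injective j e)) (proj₂ (coefficients y)))

  extend : ∀ {j} d (ws : Vec (Fin (2 ^ n)) j) → Independent ws → j + d ≤ n →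
    Σ (Vec (Fin (2 ^ n)) d) λ us → Independent (us ++ ws)
  extend zero    ws independent _ = [] , independent
  extend {j} (suc d) ws independent j+d+1≤n with extend d ws independent (ℕ.≤-trans (ℕ.+-monoʳ-≤ j (ℕ.n≤1+n d)) j+d+1≤n)
  ... | us , independent′ with outside-span (us ++ ws) (ℕ.≤-trans (ℕ.≤-reflexive (trans (cong suc (ℕ.+-comm d j)) (sym (ℕ.+-suc j d)))) j+d+1≤n)
  ... | g , g∉span = g ∷ us , independent-∷ (us ++ ws) g independent′ g∉span

record _≅_ {N : ℕ} (M G : BooleanGroup N) : Set where
  field
    to from : Fin N → Fin N
    to-from : ∀ y → to (from y) ≡ y
    from-to : ∀ x → from (to x) ≡ x
    to-⊕    : ∀ x y → to (BooleanGroup._⊕_ M x y) ≡ BooleanGroup._⊕_ G (to x) (to y)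

-- Complete ws to a basis (ws ++ us) and send the standard basis of Bits onto it.
Bits≅ : ∀ j d (G : BooleanGroup (2 ^ (j + d))) (ws : Vec (Fin (2 ^ (j + d))) j) → Linear.Independent G ws →
  Σ (Bits (j + d) ≅ G) λ I → ∀ bs → _≅_.to I (fromBits (j + d) (bs ++ zeros d)) ≡ Linear.lincomb G ws bs
Bits≅ j d G ws independent with Extension.extend (j + d) G d ws independent ℕ.≤-refl
... | us , independent′ = record { to = to ; from = proj₁ inverse ; to-from = proj₁ (proj₂ inverse)
                                 ; from-to = proj₂ (proj₂ inverse) ; to-⊕ = to-⊕ } , to-standard
  where
  open BooleanGroup G
  open Linear G
  n : ℕ
  n = j + d
  to : Fin (2 ^ n) → Fin (2 ^ n)
  to x = lincomb (ws ++ us) (toBits n x)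
  to-injective : ∀ {x y} → to x ≡ to y → x ≡ y
  to-injective {x} {y} e = trans (sym (fromBits-toBits n x)) (trans (cong (fromBits n)
    (independent⇒lincomb-injective (ws ++ us) (independent-swap ws us independent′) e)) (fromBits-toBits n y))
  inverse : Σ (Fin (2 ^ n) → Fin (2 ^ n)) λ from → (∀ y → to (from y) ≡ y) × (∀ x → from (to x) ≡ x)
  inverse = injective⇒inverse to to-injective
  to-⊕ : ∀ x y → to (BooleanGroup._⊕_ (Bits n) x y) ≡ to x ⊕ to y
  to-⊕ x y = trans (cong (lincomb (ws ++ us)) (toBits-fromBits n _)) (lincomb-⊻ (ws ++ us) (toBits n x) (toBits n y))
  to-standard : ∀ bs → to (fromBits n (bs ++ zeros d)) ≡ lincomb ws bs
  to-standard bs = begin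
    lincomb (ws ++ us) (toBits n (fromBits n (bs ++ zeros d)))  ≡⟨ cong (lincomb (ws ++ us)) (toBits-fromBits n _) ⟩
    lincomb (ws ++ us) (bs ++ zeros d)                          ≡⟨ lincomb-++ ws us bs (zeros d) ⟩
    lincomb ws bs ⊕ lincomb us (zeros d)                        ≡⟨ cong (lincomb ws bs ⊕_) (lincomb-zeros us) ⟩
    lincomb ws bs ⊕ 0ᴮ                                          ≡⟨ identityʳ _ ⟩
    lincomb ws bs                                               ∎
    where open ≡-Reasoning

∧-true : ∀ {a b} → a ∧ b ≡ true → a ≡ true × b ≡ true
∧-true {true} {true} _ = refl , refl

∧-intro : ∀ {a b} → a ≡ true → b ≡ true → a ∧ b ≡ true
∧-intro refl refl = refl

does-reflects : {P : Set} (P? : Dec P) (b : Bool) → (P → b ≡ true) → (b ≡ true → P) → ⌊ P? ⌋ ≡ b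
does-reflects (yes p) true  f g = refl
does-reflects (yes p) false f g = sym (f p)
does-reflects (no ¬p) true  f g = ⊥-elim (¬p (g refl))
does-reflects (no ¬p) false f g = refl

infix 4 _==_
_==_ : ∀ {n} → Fin n → Fin n → Bool
a == b = ⌊ a ≟ b ⌋

==-refl : ∀ {n} (a : Fin n) → (a == a) ≡ true
==-refl a with a ≟ a
... | yes _   = refl
... | no a≢a = ⊥-elim (a≢a refl)

==⇒≡ : ∀ {n} {a b : Fin n} → (a == b) ≡ true → a ≡ b
==⇒≡ {a = a} {b} e with a ≟ b
... | yes a≡b = a≡b

==-injective : ∀ {n m} (f : Fin n → Fin m) → (∀ {a b} → f a ≡ f b → a ≡ b) → ∀ a b → (f a == f b) ≡ (a == b)
==-injective f f-injective a b = does-reflects (f a ≟ f b) (a == b) (λ e → subst (λ z → (a == z) ≡ true) (f-injective e) (==-refl a)) (cong f ∘ ==⇒≡)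

open MonoidSum Bool.∧-isCommutativeMonoid public using () renaming
  (sum to ⋀; sum-cong to ⋀-cong; sum-permute to ⋀-permute; sum-allFin-suc to ⋀-allFin-suc; sum-distrib to ⋀-distrib)

allᵇ : ∀ {n} → (Fin n → Bool) → Bool
allᵇ {n} f = ⋀ f (allFin n)

allᵇ-cong : ∀ {n} {f g : Fin n → Bool} → (∀ r → f r ≡ g r) → allᵇ f ≡ allᵇ g
allᵇ-cong {n} h = ⋀-cong (allFin n) (λ {r} _ → h r)

allᵇ-true⇒ : ∀ {n} (f : Fin n → Bool) → allᵇ f ≡ true → ∀ r → f r ≡ true
allᵇ-true⇒ {n} f e r = go (allFin n) e (∈-allFin r)
  where
  go : ∀ xs → ⋀ f xs ≡ true → r ∈ₗ xs → f r ≡ true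
  go (x ∷ xs) e (here refl) = proj₁ (∧-true e)
  go (x ∷ xs) e (there r∈) = go xs (proj₂ (∧-true {f x} e)) r∈

⇒allᵇ-true : ∀ {n} (f : Fin n → Bool) → (∀ r → f r ≡ true) → allᵇ f ≡ true
⇒allᵇ-true {n} f h = go (allFin n)
  where
  go : ∀ xs → ⋀ f xs ≡ true
  go []       = refl
  go (x ∷ xs) = ∧-intro (h x) (go xs)

-- isBlock k α x y S: S is in U_{α,k} and contains x and y; S ⊆ V_α and S ∩ (S + α) = ∅ are tested pointwise.
module Blocks {N : ℕ} (G : BooleanGroup N) where
  open BooleanGroup G

  isBlock : ℕ → Fin N → Fin N → Fin N → Subset N → Bool
  isBlock k α x y S = allᵇ (λ z → not (lookup S z) ∨ (not (z == 0ᴮ) ∧ not (z == α) ∧ not (lookup S (z ⊕ α))))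
    ∧ (∣ S ∣ ≡ᵇ k) ∧ (Σᴮ S == α) ∧ lookup S x ∧ lookup S y

  isZeroSumBlock : ℕ → Fin N → Fin N → Subset N → Bool
  isZeroSumBlock k a b S = allᵇ (λ z → not (lookup S z) ∨ not (z == 0ᴮ))
    ∧ (∣ S ∣ ≡ᵇ k) ∧ (Σᴮ S == 0ᴮ) ∧ lookup S a ∧ lookup S b

module Transport {N : ℕ} {M G : BooleanGroup N} (I : M ≅ G) where
  open _≅_ I
  private
    module M = BooleanGroup M
    module G = BooleanGroup G
    module BM = Blocks M
    module BG = Blocks G

  to-injective : ∀ {a b} → to a ≡ to b → a ≡ b
  to-injective {a} {b} e = trans (sym (from-to a)) (trans (cong from e) (from-to b))

  to-0ᴮ : to M.0ᴮ ≡ G.0ᴮ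
  to-0ᴮ = trans (cong to (sym (M.x⊕x≡0ᴮ M.0ᴮ))) (trans (to-⊕ M.0ᴮ M.0ᴮ) (G.x⊕x≡0ᴮ (to M.0ᴮ)))

  from-⊕ : ∀ a b → from (a G.⊕ b) ≡ from a M.⊕ from b
  from-⊕ a b = to-injective (trans (to-from _) (sym (trans (to-⊕ (from a) (from b)) (cong₂ G._⊕_ (to-from a) (to-from b)))))

  allᵇ-to : (f : Fin N → Bool) → allᵇ f ≡ allᵇ (f ∘ to)
  allᵇ-to = ⋀-permute (Unique.allFin⁺ N) ∈-allFin to from to-from from-to

  lookup-preimage-to : ∀ T w → lookup (preimage from T) (to w) ≡ lookup T w
  lookup-preimage-to T w = trans (lookup-preimage from T (to w)) (cong (lookup T) (from-to w))

  Σᴮ-preimage : ∀ T → G.Σᴮ (preimage from T) ≡ to (M.Σᴮ T)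
  Σᴮ-preimage T = begin
    G.Σᴮ (preimage from T)                                              ≡⟨ G.sum-permute (Unique.allFin⁺ N) ∈-allFin to from to-from from-to _ ⟩
    G.sum (λ w → if lookup (preimage from T) (to w) then to w else G.0ᴮ) (allFin N) ≡⟨ G.sum-cong (allFin N) (λ {w} _ → pointwise w) ⟩
    G.sum (λ w → to (if lookup T w then w else M.0ᴮ)) (allFin N)        ≡⟨ SumHomomorphism.sum-hom M.isCommutativeMonoid G.isCommutativeMonoid to to-0ᴮ to-⊕ _ (allFin N) ⟨
    to (M.Σᴮ T)                                                         ∎
    where
    open ≡-Reasoning
    pointwise : ∀ w → (if lookup (preimage from T) (to w) then to w else G.0ᴮ) ≡ to (if lookup T w then w else M.0ᴮ)
    pointwise w rewrite lookup-preimage-to T w with lookup T w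
    ... | true  = refl
    ... | false = sym to-0ᴮ

  ==-to : ∀ a b → (to a == b) ≡ (a == from b)
  ==-to a b = trans (cong (to a ==_) (sym (to-from b))) (==-injective to to-injective a (from b))

  isBlock-preimage : ∀ k α x y T → BG.isBlock k α x y (preimage from T) ≡ BM.isBlock k (from α) (from x) (from y) T
  isBlock-preimage k α x y T =
    cong₂ _∧_ (trans (allᵇ-to _) (allᵇ-cong pointwise))
    (cong₂ _∧_ (cong (_≡ᵇ k) (∣preimage∣ to from to-from from-to T))
    (cong₂ _∧_ (trans (cong (_== α) (Σᴮ-preimage T)) (==-to _ α))
    (cong₂ _∧_ (lookup-preimage from T x) (lookup-preimage from T y))))
    where
    pointwise : ∀ w → (not (lookup (preimage from T) (to w)) ∨ (not (to w == G.0ᴮ) ∧ not (to w == α) ∧ not (lookup (preimage from T) (to w G.⊕ α))))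
                    ≡ (not (lookup T w) ∨ (not (w == M.0ᴮ) ∧ not (w == from α) ∧ not (lookup T (w M.⊕ from α))))
    pointwise w = cong₂ (λ a b → not a ∨ b) (lookup-preimage-to T w)
      (cong₂ (λ a b → not a ∧ b) (trans (cong (to w ==_) (sym to-0ᴮ)) (==-injective to to-injective w M.0ᴮ))
      (cong₂ (λ a b → not a ∧ not b) (==-to w α)
        (trans (lookup-preimage from T _) (cong (lookup T) (trans (from-⊕ (to w) α) (cong (M._⊕ from α) (from-to w)))))))

  isZeroSumBlock-preimage : ∀ k a b T → BG.isZeroSumBlock k a b (preimage from T) ≡ BM.isZeroSumBlock k (from a) (from b) T
  isZeroSumBlock-preimage k a b T =
    cong₂ _∧_ (trans (allᵇ-to _) (allᵇ-cong pointwise))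
    (cong₂ _∧_ (cong (_≡ᵇ k) (∣preimage∣ to from to-from from-to T))
    (cong₂ _∧_ (trans (cong₂ _==_ (Σᴮ-preimage T) (sym to-0ᴮ)) (==-injective to to-injective _ _))
    (cong₂ _∧_ (lookup-preimage from T a) (lookup-preimage from T b))))
    where
    pointwise : ∀ w → (not (lookup (preimage from T) (to w)) ∨ not (to w == G.0ᴮ)) ≡ (not (lookup T w) ∨ not (w == M.0ᴮ))
    pointwise w = cong₂ (λ a b → not a ∨ not b) (lookup-preimage-to T w)
      (trans (cong (to w ==_) (sym to-0ᴮ)) (==-injective to to-injective w M.0ᴮ))

  count-isBlock : ∀ k α x y →
    ΣSubset N (𝟙 ∘ BG.isBlock k α x y) ≡ ΣSubset N (𝟙 ∘ BM.isBlock k (from α) (from x) (from y))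
  count-isBlock k α x y = trans (ΣSubset-preimage N to from to-from from-to _)
    (ΣSubset-cong N (cong 𝟙 ∘ isBlock-preimage k α x y))

  count-isZeroSumBlock : ∀ k a b →
    ΣSubset N (𝟙 ∘ BG.isZeroSumBlock k a b) ≡ ΣSubset N (𝟙 ∘ BM.isZeroSumBlock k (from a) (from b))
  count-isZeroSumBlock k a b = trans (ΣSubset-preimage N to from to-from from-to _)
    (ΣSubset-cong N (cong 𝟙 ∘ isZeroSumBlock-preimage k a b))

-- Counting blocks of Bits (n + 1) through e₀

odd : ℕ → Bool
odd zero    = false
odd (suc m) = not (odd m)

odd-+ : ∀ a b → odd (a + b) ≡ odd a xor odd b
odd-+ zero    b = refl
odd-+ (suc a) b = trans (cong not (odd-+ a b)) (Bool.not-distribˡ-xor (odd a) (odd b))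

xor-isCommutativeMonoid : IsCommutativeMonoid _≡_ _xor_ false
xor-isCommutativeMonoid = record
  { isMonoid = record
    { isSemigroup = record
      { isMagma = record { isEquivalence = isEquivalence ; ∙-cong = cong₂ _xor_ } ; assoc = Bool.xor-assoc }
    ; identity = Bool.xor-identity }
  ; comm = Bool.xor-comm }

open MonoidSum xor-isCommutativeMonoid using () renaming (sum to ⨁; sum-cong to ⨁-cong; sum-ε to ⨁-false)

odd∣∣≡⨁ : ∀ {m} (S : Subset m) → odd ∣ S ∣ ≡ ⨁ (lookup S) (allFin m)
odd∣∣≡⨁ {m} S = trans (cong odd (∣∣≡Σ𝟙 S)) (trans (sum-hom _ (allFin m)) (⨁-cong (allFin m) (λ {x} _ → odd-𝟙 (lookup S x))))
  where
  open SumHomomorphism ℕ.+-0-isCommutativeMonoid xor-isCommutativeMonoid odd refl odd-+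
  odd-𝟙 : ∀ b → odd (𝟙 b) ≡ b
  odd-𝟙 true  = refl
  odd-𝟙 false = refl

∣++∣ : ∀ {a b} (xs : Vec Bool a) (ys : Vec Bool b) → ∣ xs ++ ys ∣ ≡ ∣ xs ∣ + ∣ ys ∣
∣++∣ []           ys = refl
∣++∣ (false ∷ xs) ys = ∣++∣ xs ys
∣++∣ (true ∷ xs)  ys = cong suc (∣++∣ xs ys)

≟-true : ∀ b → ⌊ b Bool.≟ true ⌋ ≡ b
≟-true true  = refl
≟-true false = refl

-- Bits (suc n) as Bool × Bits n: the first bit and the rest.
module Halves (n : ℕ) where
  private
    N : ℕ
    N = 2 ^ n
    module B₀ = BooleanGroup (Bits n)
    module B₁ = BooleanGroup (Bits (suc n))

  ⟨_,_⟩ : Bool → Fin N → Fin (2 ^ suc n)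
  ⟨ b , r ⟩ = combine (unbit b) r

  hd : Fin (2 ^ suc n) → Bool
  hd z = bit (proj₁ (remQuot {2} N z))

  tl : Fin (2 ^ suc n) → Fin N
  tl z = proj₂ (remQuot {2} N z)

  hd-⟨⟩ : ∀ b r → hd ⟨ b , r ⟩ ≡ b
  hd-⟨⟩ b r = trans (cong (bit ∘ proj₁) (remQuot-combine {2} {N} (unbit b) r)) (bit-unbit b)

  tl-⟨⟩ : ∀ b r → tl ⟨ b , r ⟩ ≡ r
  tl-⟨⟩ b r = cong proj₂ (remQuot-combine {2} {N} (unbit b) r)

  ⟨hd,tl⟩ : ∀ z → ⟨ hd z , tl z ⟩ ≡ z
  ⟨hd,tl⟩ z = trans (cong (λ i → combine i (tl z)) (unbit-bit (proj₁ (remQuot {2} N z)))) (combine-remQuot {2} N z)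

  ⟨⟩-injective : ∀ b r b' r' → ⟨ b , r ⟩ ≡ ⟨ b' , r' ⟩ → b ≡ b' × r ≡ r'
  ⟨⟩-injective b r b' r' e =
    trans (sym (hd-⟨⟩ b r)) (trans (cong hd e) (hd-⟨⟩ b' r')) , trans (sym (tl-⟨⟩ b r)) (trans (cong tl e) (tl-⟨⟩ b' r'))

  ⟨⟩-⊕ : ∀ b r b' r' → ⟨ b , r ⟩ B₁.⊕ ⟨ b' , r' ⟩ ≡ ⟨ b xor b' , r B₀.⊕ r' ⟩
  ⟨⟩-⊕ b r b' r' = cong (fromBits (suc n)) (cong₂ _⊻_ (toBits-⟨⟩ b r) (toBits-⟨⟩ b' r'))
    where
    toBits-⟨⟩ : ∀ b r → toBits (suc n) ⟨ b , r ⟩ ≡ b ∷ toBits n r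
    toBits-⟨⟩ b r = trans (cong (bits n) (remQuot-combine {2} {N} (unbit b) r)) (cong (_∷ toBits n r) (bit-unbit b))

  ⊕-split : ∀ z w → z B₁.⊕ w ≡ ⟨ hd z xor hd w , tl z B₀.⊕ tl w ⟩
  ⊕-split z w = trans (cong₂ B₁._⊕_ (sym (⟨hd,tl⟩ z)) (sym (⟨hd,tl⟩ w))) (⟨⟩-⊕ (hd z) (tl z) (hd w) (tl w))

  hd-⊕ : ∀ z w → hd (z B₁.⊕ w) ≡ hd z xor hd w
  hd-⊕ z w = trans (cong hd (⊕-split z w)) (hd-⟨⟩ _ _)

  tl-⊕ : ∀ z w → tl (z B₁.⊕ w) ≡ tl z B₀.⊕ tl w
  tl-⊕ z w = trans (cong tl (⊕-split z w)) (tl-⟨⟩ (hd z xor hd w) _)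

  ==-⟨⟩ : ∀ b r b' r' → (⟨ b , r ⟩ == ⟨ b' , r' ⟩) ≡ (⌊ b Bool.≟ b' ⌋ ∧ (r == r'))
  ==-⟨⟩ b r b' r' = does-reflects (⟨ b , r ⟩ ≟ ⟨ b' , r' ⟩) _ forward backward
    where
    forward : ⟨ b , r ⟩ ≡ ⟨ b' , r' ⟩ → (⌊ b Bool.≟ b' ⌋ ∧ (r == r')) ≡ true
    forward e with ⟨⟩-injective b r b' r' e
    ... | refl , refl = ∧-intro (Bool-≟-refl b) (==-refl r)
      where
      Bool-≟-refl : ∀ b → ⌊ b Bool.≟ b ⌋ ≡ true
      Bool-≟-refl true  = refl
      Bool-≟-refl false = refl
    backward : (⌊ b Bool.≟ b' ⌋ ∧ (r == r')) ≡ true → ⟨ b , r ⟩ ≡ ⟨ b' , r' ⟩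
    backward e with b Bool.≟ b' | ∧-true {⌊ b Bool.≟ b' ⌋} e
    ... | yes refl | _ , r==r' = cong ⟨ b ,_⟩ (==⇒≡ r==r')

  ==-split : ∀ z b' r' → (z == ⟨ b' , r' ⟩) ≡ (⌊ hd z Bool.≟ b' ⌋ ∧ (tl z == r'))
  ==-split z b' r' = trans (cong (_== ⟨ b' , r' ⟩) (sym (⟨hd,tl⟩ z))) (==-⟨⟩ (hd z) (tl z) b' r')

  -- 2 ^ suc n reduces to N + (N + 0), hence the trailing [].
  glue : Subset N → Subset N → Subset (2 ^ suc n)
  glue S₀ S₁ = S₀ ++ (S₁ ++ [])

  lookup-glue₀ : ∀ S₀ S₁ r → lookup (glue S₀ S₁) ⟨ false , r ⟩ ≡ lookup S₀ r
  lookup-glue₀ S₀ S₁ r = Vec.lookup-++ˡ S₀ (S₁ ++ []) r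

  lookup-glue₁ : ∀ S₀ S₁ r → lookup (glue S₀ S₁) ⟨ true , r ⟩ ≡ lookup S₁ r
  lookup-glue₁ S₀ S₁ r = trans (Vec.lookup-++ʳ S₀ (S₁ ++ []) _) (Vec.lookup-++ˡ S₁ [] r)

  ∣glue∣ : ∀ S₀ S₁ → ∣ glue S₀ S₁ ∣ ≡ ∣ S₀ ∣ + ∣ S₁ ∣
  ∣glue∣ S₀ S₁ = trans (∣++∣ S₀ (S₁ ++ [])) (cong (∣ S₀ ∣ +_) (trans (∣++∣ S₁ []) (ℕ.+-identityʳ _)))

  halves : List (Fin (2 ^ suc n))
  halves = map ⟨ false ,_⟩ (allFin N) L.++ map ⟨ true ,_⟩ (allFin N)

  halves-unique : Unique halves
  halves-unique = Unique.++⁺ (Unique.map⁺ (λ {r} {r'} → proj₂ ∘ ⟨⟩-injective false r false r') (Unique.allFin⁺ N))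
    (Unique.map⁺ (λ {r} {r'} → proj₂ ∘ ⟨⟩-injective true r true r') (Unique.allFin⁺ N)) disjoint
    where
    disjoint : ∀ {z} → ¬ (z ∈ₗ map ⟨ false ,_⟩ (allFin N) × z ∈ₗ map ⟨ true ,_⟩ (allFin N))
    disjoint (p , q) with ∈-map⁻ ⟨ false ,_⟩ p | ∈-map⁻ ⟨ true ,_⟩ q
    ... | r , _ , refl | r' , _ , e with proj₁ (⟨⟩-injective false r true r' e)
    ... | ()

  halves-complete : ∀ z → z ∈ₗ halves
  halves-complete z = subst (_∈ₗ halves) (⟨hd,tl⟩ z) (∈-halves (hd z) (tl z))
    where
    ∈-halves : ∀ b r → ⟨ b , r ⟩ ∈ₗ halves
    ∈-halves false r = ∈-++⁺ˡ (∈-map⁺ ⟨ false ,_⟩ (∈-allFin r))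
    ∈-halves true  r = ∈-++⁺ʳ (map ⟨ false ,_⟩ (allFin N)) (∈-map⁺ ⟨ true ,_⟩ (∈-allFin r))

  module _ {A : Set} {_∙_ : Op₂ A} {ε : A} (isCM : IsCommutativeMonoid _≡_ _∙_ ε) where
    open MonoidSum isCM

    sum-halves : (f : Fin (2 ^ suc n) → A) →
      sum f (allFin (2 ^ suc n)) ≡ sum (f ∘ ⟨ false ,_⟩) (allFin N) ∙ sum (f ∘ ⟨ true ,_⟩) (allFin N)
    sum-halves f = trans (sum-↭ f (unique⇒↭ (Unique.allFin⁺ _) halves-unique (λ {z} _ → halves-complete z) (λ {z} _ → ∈-allFin z)))
      (trans (sum-++ f (map ⟨ false ,_⟩ (allFin N)) _) (cong₂ _∙_ (sum-map f _ (allFin N)) (sum-map f _ (allFin N))))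

  e₀ : Fin (2 ^ suc n)
  e₀ = ⟨ true , B₀.0ᴮ ⟩

  tl-Σᴮ-glue : ∀ S₀ S₁ → tl (B₁.Σᴮ (glue S₀ S₁)) ≡ B₀.Σᴮ S₀ B₀.⊕ B₀.Σᴮ S₁
  tl-Σᴮ-glue S₀ S₁ = trans (sum-hom _ (allFin (2 ^ suc n))) (trans (sum-halves B₀.isCommutativeMonoid _)
    (cong₂ B₀._⊕_ (B₀.sum-cong (allFin N) (λ {r} _ → pointwise false S₀ r (lookup-glue₀ S₀ S₁ r)))
                  (B₀.sum-cong (allFin N) (λ {r} _ → pointwise true S₁ r (lookup-glue₁ S₀ S₁ r)))))
    where
    open SumHomomorphism B₁.isCommutativeMonoid B₀.isCommutativeMonoid tl (tl-⟨⟩ false B₀.0ᴮ) tl-⊕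
    pointwise : ∀ b S r → lookup (glue S₀ S₁) ⟨ b , r ⟩ ≡ lookup S r →
      tl (if lookup (glue S₀ S₁) ⟨ b , r ⟩ then ⟨ b , r ⟩ else B₁.0ᴮ) ≡ (if lookup S r then r else B₀.0ᴮ)
    pointwise b S r e rewrite e with lookup S r
    ... | true  = tl-⟨⟩ b r
    ... | false = tl-⟨⟩ false B₀.0ᴮ

  hd-Σᴮ-glue : ∀ S₀ S₁ → hd (B₁.Σᴮ (glue S₀ S₁)) ≡ odd ∣ S₁ ∣
  hd-Σᴮ-glue S₀ S₁ = trans (sum-hom _ (allFin (2 ^ suc n))) (trans (sum-halves xor-isCommutativeMonoid _)
    (cong₂ _xor_ (trans (⨁-cong (allFin N) (λ {r} _ → pointwise false S₀ r (lookup-glue₀ S₀ S₁ r))) (⨁-false (allFin N)))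
                 (trans (⨁-cong (allFin N) (λ {r} _ → pointwise true S₁ r (lookup-glue₁ S₀ S₁ r))) (sym (odd∣∣≡⨁ S₁)))))
    where
    open SumHomomorphism B₁.isCommutativeMonoid xor-isCommutativeMonoid hd (hd-⟨⟩ false B₀.0ᴮ) hd-⊕
    pointwise : ∀ b S r → lookup (glue S₀ S₁) ⟨ b , r ⟩ ≡ lookup S r →
      hd (if lookup (glue S₀ S₁) ⟨ b , r ⟩ then ⟨ b , r ⟩ else B₁.0ᴮ) ≡ (b ∧ lookup S r)
    pointwise b S r e rewrite e with lookup S r
    ... | true  = trans (hd-⟨⟩ b r) (sym (Bool.∧-identityʳ b))
    ... | false = trans (hd-⟨⟩ false B₀.0ᴮ) (sym (Bool.∧-zeroʳ b))

  Σᴮ-glue==e₀ : ∀ S₀ S₁ → (B₁.Σᴮ (glue S₀ S₁) == e₀) ≡ (odd ∣ S₁ ∣ ∧ (B₀.Σᴮ S₀ B₀.⊕ B₀.Σᴮ S₁ == B₀.0ᴮ))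
  Σᴮ-glue==e₀ S₀ S₁ = trans (==-split _ true B₀.0ᴮ)
    (cong₂ _∧_ (trans (cong (λ b → ⌊ b Bool.≟ true ⌋) (hd-Σᴮ-glue S₀ S₁)) (≟-true _)) (cong (_== B₀.0ᴮ) (tl-Σᴮ-glue S₀ S₁)))

  isSplitBlock : ℕ → Fin N → Fin N → Subset N → Subset N → Bool
  isSplitBlock k u v S₀ S₁ =
    (allᵇ (λ r → not (lookup S₀ r) ∨ (not (r == B₀.0ᴮ) ∧ not (lookup S₁ r)))
      ∧ allᵇ (λ r → not (lookup S₁ r) ∨ (not (r == B₀.0ᴮ) ∧ not (lookup S₀ r))))
    ∧ ((∣ S₀ ∣ + ∣ S₁ ∣) ≡ᵇ k) ∧ (odd ∣ S₁ ∣ ∧ (B₀.Σᴮ S₀ B₀.⊕ B₀.Σᴮ S₁ == B₀.0ᴮ)) ∧ lookup S₀ u ∧ lookup S₀ v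

  isBlock-glue : ∀ k u v S₀ S₁ →
    Blocks.isBlock (Bits (suc n)) k e₀ ⟨ false , u ⟩ ⟨ false , v ⟩ (glue S₀ S₁) ≡ isSplitBlock k u v S₀ S₁
  isBlock-glue k u v S₀ S₁ =
    cong₂ _∧_ (trans (sum-halves Bool.∧-isCommutativeMonoid _) (cong₂ _∧_ (allᵇ-cong pointwise₀) (allᵇ-cong pointwise₁)))
    (cong₂ _∧_ (cong (_≡ᵇ k) (∣glue∣ S₀ S₁))
    (cong₂ _∧_ (Σᴮ-glue==e₀ S₀ S₁) (cong₂ _∧_ (lookup-glue₀ S₀ S₁ u) (lookup-glue₀ S₀ S₁ v))))
    where
    S : Subset (2 ^ suc n)
    S = glue S₀ S₁
    pointwise₀ : ∀ r → (not (lookup S ⟨ false , r ⟩) ∨ (not (⟨ false , r ⟩ == B₁.0ᴮ) ∧ not (⟨ false , r ⟩ == e₀) ∧ not (lookup S (⟨ false , r ⟩ B₁.⊕ e₀))))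
                     ≡ (not (lookup S₀ r) ∨ (not (r == B₀.0ᴮ) ∧ not (lookup S₁ r)))
    pointwise₀ r rewrite lookup-glue₀ S₀ S₁ r | ==-⟨⟩ false r false B₀.0ᴮ | ==-⟨⟩ false r true B₀.0ᴮ
                       | ⟨⟩-⊕ false r true B₀.0ᴮ | lookup-glue₁ S₀ S₁ (r B₀.⊕ B₀.0ᴮ) | B₀.identityʳ r = refl
    pointwise₁ : ∀ r → (not (lookup S ⟨ true , r ⟩) ∨ (not (⟨ true , r ⟩ == B₁.0ᴮ) ∧ not (⟨ true , r ⟩ == e₀) ∧ not (lookup S (⟨ true , r ⟩ B₁.⊕ e₀))))
                     ≡ (not (lookup S₁ r) ∨ (not (r == B₀.0ᴮ) ∧ not (lookup S₀ r)))
    pointwise₁ r rewrite lookup-glue₁ S₀ S₁ r | ==-⟨⟩ true r false B₀.0ᴮ | ==-⟨⟩ true r true B₀.0ᴮ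
                       | ⟨⟩-⊕ true r true B₀.0ᴮ | lookup-glue₀ S₀ S₁ (r B₀.⊕ B₀.0ᴮ) | B₀.identityʳ r = refl

Σℕ-comm : {A B : Set} (f : A → B → ℕ) (xs : List A) (ys : List B) →
  Σℕ (λ x → Σℕ (f x) ys) xs ≡ Σℕ (λ y → Σℕ (λ x → f x y) xs) ys
Σℕ-comm f []       ys = sym (Σℕ-0 ys)
Σℕ-comm f (x ∷ xs) ys = trans (cong (Σℕ (f x) ys +_) (Σℕ-comm f xs ys)) (sym (Σℕ-+ (f x) _ ys))

ΣSubset²-shear : ∀ n (f : Subset n → Subset n → ℕ) →
  ΣSubset n (λ S₀ → ΣSubset n (f S₀)) ≡ ΣSubset n (λ C → ΣSubset n (λ T → f (C ⊻ T) T))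
ΣSubset²-shear n f = begin
  ΣSubset n (λ S₀ → ΣSubset n (f S₀))                ≡⟨ Σℕ-comm f (allSubsets n) (allSubsets n) ⟩
  ΣSubset n (λ T → ΣSubset n (λ S₀ → f S₀ T))         ≡⟨ ΣSubset-cong n (λ T → shift T) ⟩
  ΣSubset n (λ T → ΣSubset n (λ C → f (C ⊻ T) T))     ≡⟨ Σℕ-comm (λ C T → f (C ⊻ T) T) (allSubsets n) (allSubsets n) ⟨
  ΣSubset n (λ C → ΣSubset n (λ T → f (C ⊻ T) T))     ∎
  where
  open ≡-Reasoning
  shift : ∀ T → ΣSubset n (λ S₀ → f S₀ T) ≡ ΣSubset n (λ C → f (C ⊻ T) T)
  shift T = Σℕ-permute (allSubsets-unique n) allSubsets-complete (_⊻ T) (_⊻ T) (λ C → ⊻-cancelʳ C T) (λ C → ⊻-cancelʳ C T) _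

infix 4 _⊆ᵇ_
_⊆ᵇ_ : ∀ {m} → Subset m → Subset m → Bool
[]      ⊆ᵇ []      = true
(t ∷ T) ⊆ᵇ (d ∷ D) = (not t ∨ d) ∧ (T ⊆ᵇ D)

⊆ᵇ≡allᵇ : ∀ {m} (T D : Subset m) → (T ⊆ᵇ D) ≡ allᵇ (λ r → not (lookup T r) ∨ lookup D r)
⊆ᵇ≡allᵇ []      []      = refl
⊆ᵇ≡allᵇ (t ∷ T) (d ∷ D) = trans (cong ((not t ∨ d) ∧_) (⊆ᵇ≡allᵇ T D))
  (sym (⋀-allFin-suc (λ r → not (lookup (t ∷ T) r) ∨ lookup (d ∷ D) r)))

≡ᵇ-true⇒≡ : ∀ {a b} → (a ≡ᵇ b) ≡ true → a ≡ b
≡ᵇ-true⇒≡ {a} {b} e = ℕ.≡ᵇ⇒≡ a b (subst T (sym e) _)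

≡ᵇ-refl : ∀ a → (a ≡ᵇ a) ≡ true
≡ᵇ-refl zero    = refl
≡ᵇ-refl (suc a) = ≡ᵇ-refl a

𝟙-∧ : ∀ a b → 𝟙 (a ∧ b) ≡ 𝟙 a * 𝟙 b
𝟙-∧ true  b = sym (ℕ.+-identityʳ (𝟙 b))
𝟙-∧ false b = refl

true≢false : true ≢ false
true≢false ()

∨-implies : ∀ {t d} → (not t ∨ d) ≡ true → t ≡ true → d ≡ true
∨-implies {true} h refl = h

implies-∨ : ∀ {t d} → (t ≡ true → d ≡ true) → (not t ∨ d) ≡ true
implies-∨ {false} f = refl
implies-∨ {true}  f = f refl

⊆ᵇ-true⇒ : ∀ {m} (T D : Subset m) → (T ⊆ᵇ D) ≡ true → ∀ r → lookup T r ≡ true → lookup D r ≡ true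
⊆ᵇ-true⇒ T D h r = ∨-implies (allᵇ-true⇒ _ (trans (sym (⊆ᵇ≡allᵇ T D)) h) r)

⇒⊆ᵇ-true : ∀ {m} (T D : Subset m) → (∀ r → lookup T r ≡ true → lookup D r ≡ true) → (T ⊆ᵇ D) ≡ true
⇒⊆ᵇ-true T D h = trans (⊆ᵇ≡allᵇ T D) (⇒allᵇ-true _ (λ r → implies-∨ (h r)))

paritySubsets : ∀ {m} → Subset m → Bool → ℕ
paritySubsets {m} D p = ΣSubset m (λ T → 𝟙 ((T ⊆ᵇ D) ∧ (p xor odd ∣ T ∣)))

paritySubsets-outside : ∀ {m} (D : Subset m) p → paritySubsets (false ∷ D) p ≡ paritySubsets D p
paritySubsets-outside {m} D p = trans (ΣSubset-suc m _) (trans (cong (paritySubsets D p +_) (Σℕ-0 (allSubsets m))) (ℕ.+-identityʳ _))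

paritySubsets-inside : ∀ {m} (D : Subset m) p → paritySubsets (true ∷ D) p ≡ paritySubsets D p + paritySubsets D (not p)
paritySubsets-inside {m} D p = trans (ΣSubset-suc m _) (cong (paritySubsets D p +_) (ΣSubset-cong m (λ T →
  cong (λ b → 𝟙 ((T ⊆ᵇ D) ∧ b)) (trans (sym (Bool.not-distribʳ-xor p (odd ∣ T ∣))) (Bool.not-distribˡ-xor p (odd ∣ T ∣))))))

paritySubsets-total : ∀ {m} (D : Subset m) p → paritySubsets D p + paritySubsets D (not p) ≡ 2 ^ ∣ D ∣
paritySubsets-total []          true  = refl
paritySubsets-total []          false = refl
paritySubsets-total (false ∷ D) p =
  trans (cong₂ _+_ (paritySubsets-outside D p) (paritySubsets-outside D (not p))) (paritySubsets-total D p)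
paritySubsets-total (true ∷ D)  p = begin
  paritySubsets (true ∷ D) p + paritySubsets (true ∷ D) (not p)
    ≡⟨ cong₂ _+_ (paritySubsets-inside D p) (trans (paritySubsets-inside D (not p)) (cong (paritySubsets D (not p) +_) (cong (paritySubsets D) (Bool.not-involutive p)))) ⟩
  (paritySubsets D p + paritySubsets D (not p)) + (paritySubsets D (not p) + paritySubsets D p)
    ≡⟨ cong ((paritySubsets D p + paritySubsets D (not p)) +_) (ℕ.+-comm (paritySubsets D (not p)) _) ⟩
  (paritySubsets D p + paritySubsets D (not p)) + (paritySubsets D p + paritySubsets D (not p))
    ≡⟨ cong (λ z → z + z) (paritySubsets-total D p) ⟩
  2 ^ ∣ D ∣ + 2 ^ ∣ D ∣
    ≡⟨ cong (2 ^ ∣ D ∣ +_) (ℕ.+-identityʳ _) ⟨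
  2 ^ suc ∣ D ∣ ∎
  where open ≡-Reasoning

-- Flipping membership of one fixed element of D is a parity-reversing involution.
paritySubsets-half : ∀ {m} (D : Subset m) p j → ∣ D ∣ ≡ suc j → paritySubsets D p ≡ 2 ^ j
paritySubsets-half (true ∷ D)  p j e = trans (paritySubsets-inside D p) (trans (paritySubsets-total D p) (cong (2 ^_) (ℕ.suc-injective e)))
paritySubsets-half (false ∷ D) p j e = trans (paritySubsets-outside D p) (paritySubsets-half D p j e)

∣⊻∣+∣∣ : ∀ {m} (C T : Subset m) → (T ⊆ᵇ C) ≡ true → ∣ C ⊻ T ∣ + ∣ T ∣ ≡ ∣ C ∣
∣⊻∣+∣∣ []         []          _ = refl
∣⊻∣+∣∣ (true ∷ C)  (true ∷ T)  h = trans (ℕ.+-suc _ _) (cong suc (∣⊻∣+∣∣ C T h))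
∣⊻∣+∣∣ (true ∷ C)  (false ∷ T) h = cong suc (∣⊻∣+∣∣ C T h)
∣⊻∣+∣∣ (false ∷ C) (false ∷ T) h = ∣⊻∣+∣∣ C T h

module _ {N : ℕ} (G : BooleanGroup N) where
  open BooleanGroup G
  open Linear G using (scale-xor)

  Σᴮ-⊻ : ∀ (C T : Subset N) → Σᴮ (C ⊻ T) ⊕ Σᴮ T ≡ Σᴮ C
  Σᴮ-⊻ C T = begin
    Σᴮ (C ⊻ T) ⊕ Σᴮ T        ≡⟨ cong (_⊕ Σᴮ T) (trans (sum-cong (allFin N) (λ {r} _ → pointwise r)) (sum-distrib _ _ (allFin N))) ⟩
    (Σᴮ C ⊕ Σᴮ T) ⊕ Σᴮ T     ≡⟨ assoc _ _ _ ⟩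
    Σᴮ C ⊕ (Σᴮ T ⊕ Σᴮ T)     ≡⟨ cong (Σᴮ C ⊕_) (x⊕x≡0ᴮ _) ⟩
    Σᴮ C ⊕ 0ᴮ                 ≡⟨ identityʳ _ ⟩
    Σᴮ C                      ∎
    where
    open ≡-Reasoning
    pointwise : ∀ r → (if lookup (C ⊻ T) r then r else 0ᴮ) ≡ (if lookup C r then r else 0ᴮ) ⊕ (if lookup T r then r else 0ᴮ)
    pointwise r = trans (cong (λ b → if b then r else 0ᴮ) (Vec.lookup-zipWith _xor_ r C T)) (scale-xor (lookup C r) (lookup T r) r)

module LiftCount (n : ℕ) where
  open Halves n
  private
    N : ℕ
    N = 2 ^ n
    module B₀ = BooleanGroup (Bits n)
    module Z = Blocks (Bits n)

  nonzeroᵇ : Subset N → Bool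
  nonzeroᵇ C = allᵇ (λ r → not (lookup C r) ∨ not (r == B₀.0ᴮ))

  halves-disjoint-nonzero : ∀ C T →
    (allᵇ (λ r → not (lookup (C ⊻ T) r) ∨ (not (r == B₀.0ᴮ) ∧ not (lookup T r)))
      ∧ allᵇ (λ r → not (lookup T r) ∨ (not (r == B₀.0ᴮ) ∧ not (lookup (C ⊻ T) r))))
    ≡ (nonzeroᵇ C ∧ (T ⊆ᵇ C))
  halves-disjoint-nonzero C T = begin
    allᵇ first ∧ allᵇ second                    ≡⟨ ⋀-distrib first second (allFin N) ⟨
    allᵇ (λ r → first r ∧ second r)             ≡⟨ allᵇ-cong pointwise ⟩
    allᵇ (λ r → nonzero r ∧ inC r)              ≡⟨ ⋀-distrib nonzero inC (allFin N) ⟩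
    nonzeroᵇ C ∧ allᵇ inC                       ≡⟨ cong (nonzeroᵇ C ∧_) (⊆ᵇ≡allᵇ T C) ⟨
    nonzeroᵇ C ∧ (T ⊆ᵇ C)                       ∎
    where
    open ≡-Reasoning
    first second nonzero inC : Fin N → Bool
    first   r = not (lookup (C ⊻ T) r) ∨ (not (r == B₀.0ᴮ) ∧ not (lookup T r))
    second  r = not (lookup T r) ∨ (not (r == B₀.0ᴮ) ∧ not (lookup (C ⊻ T) r))
    nonzero r = not (lookup C r) ∨ not (r == B₀.0ᴮ)
    inC     r = not (lookup T r) ∨ lookup C r
    identity : ∀ c t e → ((not (c xor t) ∨ (not e ∧ not t)) ∧ (not t ∨ (not e ∧ not (c xor t)))) ≡ ((not c ∨ not e) ∧ (not t ∨ c))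
    identity true  true  true  = refl
    identity true  true  false = refl
    identity true  false true  = refl
    identity true  false false = refl
    identity false true  true  = refl
    identity false true  false = refl
    identity false false true  = refl
    identity false false false = refl
    pointwise : ∀ r → first r ∧ second r ≡ nonzero r ∧ inC r
    pointwise r rewrite Vec.lookup-zipWith _xor_ r C T = identity (lookup C r) (lookup T r) (r == B₀.0ᴮ)

  remove₂ : Fin N → Fin N → Subset N → Subset N
  remove₂ u v C = tabulate (λ r → lookup C r ∧ not (r == u) ∧ not (r == v))

  lookup-remove₂ : ∀ u v C r → lookup (remove₂ u v C) r ≡ (lookup C r ∧ not (r == u) ∧ not (r == v))
  lookup-remove₂ u v C r = Vec.lookup∘tabulate _ r

  ∣remove₂∣ : ∀ u v C → u ≢ v → lookup C u ≡ true → lookup C v ≡ true → ∣ C ∣ ≡ ∣ remove₂ u v C ∣ + 2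
  ∣remove₂∣ u v C u≢v Cu Cv = begin
    ∣ C ∣                                                             ≡⟨ ∣∣≡Σ𝟙 C ⟩
    Σℕ (𝟙 ∘ lookup C) (allFin N)                                      ≡⟨ Σℕ-cong (allFin N) (λ {r} _ → pointwise r) ⟩
    Σℕ (λ r → 𝟙 (lookup (remove₂ u v C) r) + (𝟙 (r == u) + 𝟙 (r == v))) (allFin N)
                                                                      ≡⟨ Σℕ-+ _ _ (allFin N) ⟩
    Σℕ (𝟙 ∘ lookup (remove₂ u v C)) (allFin N) + Σℕ (λ r → 𝟙 (r == u) + 𝟙 (r == v)) (allFin N)
                                                                      ≡⟨ cong₂ _+_ (sym (∣∣≡Σ𝟙 (remove₂ u v C)))
                                                                           (trans (Σℕ-+ _ _ (allFin N)) (cong₂ _+_ (Σℕ-𝟙≟ N u) (Σℕ-𝟙≟ N v))) ⟩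
    ∣ remove₂ u v C ∣ + 2                                              ∎
    where
    open ≡-Reasoning
    pointwise : ∀ r → 𝟙 (lookup C r) ≡ 𝟙 (lookup (remove₂ u v C) r) + (𝟙 (r == u) + 𝟙 (r == v))
    pointwise r rewrite lookup-remove₂ u v C r with r ≟ u | r ≟ v
    ... | yes refl | yes refl = ⊥-elim (u≢v refl)
    ... | yes refl | no _ rewrite Cu = refl
    ... | no _ | yes refl rewrite Cv = refl
    ... | no _ | no _ with lookup C r
    ... | true  = refl
    ... | false = refl

  lifts : Fin N → Fin N → Subset N → Subset N → Bool
  lifts u v C T = (T ⊆ᵇ remove₂ u v C) ∧ odd ∣ T ∣

  private
    lookup-⊻ : ∀ (C T : Subset N) r → lookup (C ⊻ T) r ≡ lookup C r xor lookup T r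
    lookup-⊻ C T r = Vec.lookup-zipWith _xor_ r C T

    ∈-⊻⇒ : ∀ C T r → (T ⊆ᵇ C) ≡ true → lookup (C ⊻ T) r ≡ true → lookup C r ≡ true × lookup T r ≡ false
    ∈-⊻⇒ C T r T⊆C h with lookup C r in Cr | lookup T r in Tr
    ... | true  | false = refl , refl
    ... | true  | true  = ⊥-elim (true≢false (trans (sym h) (trans (lookup-⊻ C T r) (cong₂ _xor_ Cr Tr))))
    ... | false | true  = ⊥-elim (true≢false (trans (sym (⊆ᵇ-true⇒ T C T⊆C r Tr)) Cr))
    ... | false | false = ⊥-elim (true≢false (trans (sym h) (trans (lookup-⊻ C T r) (cong₂ _xor_ Cr Tr))))

  isSplitBlock-shear⇒ : ∀ k u v C T → isSplitBlock k u v (C ⊻ T) T ≡ true → (Z.isZeroSumBlock k u v C ∧ lifts u v C T) ≡ true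
  isSplitBlock-shear⇒ k u v C T h
    with ∧-true h
  ... | disjoint , h₁ with ∧-true (trans (sym (halves-disjoint-nonzero C T)) disjoint) | ∧-true h₁
  ... | nonzero , T⊆C | size , h₂ with ∧-true h₂
  ... | parity-sum , members with ∧-true parity-sum | ∧-true members
  ... | parity , sum | u∈ , v∈ =
    ∧-intro (∧-intro nonzero (∧-intro (subst (λ s → (s ≡ᵇ k) ≡ true) (∣⊻∣+∣∣ C T T⊆C) size)
            (∧-intro (subst (λ s → (s == B₀.0ᴮ) ≡ true) (Σᴮ-⊻ (Bits n) C T) sum)
            (∧-intro (proj₁ (∈-⊻⇒ C T u T⊆C u∈)) (proj₁ (∈-⊻⇒ C T v T⊆C v∈))))))
            (∧-intro (⇒⊆ᵇ-true T (remove₂ u v C) T⊆remove₂) parity)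
    where
    T⊆remove₂ : ∀ r → lookup T r ≡ true → lookup (remove₂ u v C) r ≡ true
    T⊆remove₂ r Tr rewrite lookup-remove₂ u v C r | ⊆ᵇ-true⇒ T C T⊆C r Tr with r ≟ u | r ≟ v
    ... | yes refl | _        = ⊥-elim (true≢false (trans (sym Tr) (proj₂ (∈-⊻⇒ C T u T⊆C u∈))))
    ... | no _     | yes refl = ⊥-elim (true≢false (trans (sym Tr) (proj₂ (∈-⊻⇒ C T v T⊆C v∈))))
    ... | no _     | no _     = refl

  isSplitBlock-shear⇐ : ∀ k u v C T → (Z.isZeroSumBlock k u v C ∧ lifts u v C T) ≡ true → isSplitBlock k u v (C ⊻ T) T ≡ true
  isSplitBlock-shear⇐ k u v C T h
    with ∧-true h
  ... | zero-sum , lift with ∧-true zero-sum | ∧-true lift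
  ... | nonzero , h₁ | T⊆remove₂ , parity with ∧-true h₁
  ... | size , h₂ with ∧-true h₂
  ... | sum , members with ∧-true members
  ... | Cu , Cv =
    ∧-intro (trans (halves-disjoint-nonzero C T) (∧-intro nonzero (⇒⊆ᵇ-true T C T⊆C)))
    (∧-intro (subst (λ s → (s ≡ᵇ k) ≡ true) (sym (∣⊻∣+∣∣ C T (⇒⊆ᵇ-true T C T⊆C))) size)
    (∧-intro (∧-intro parity (subst (λ s → (s == B₀.0ᴮ) ≡ true) (sym (Σᴮ-⊻ (Bits n) C T)) sum))
    (∧-intro (⇒∈-⊻ u Cu (∉T u (inj₁ (==-refl u)))) (⇒∈-⊻ v Cv (∉T v (inj₂ (==-refl v)))))))
    where
    inRemove₂ : ∀ r → lookup T r ≡ true → (lookup C r ∧ not (r == u) ∧ not (r == v)) ≡ true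
    inRemove₂ r Tr = trans (sym (lookup-remove₂ u v C r)) (⊆ᵇ-true⇒ T (remove₂ u v C) T⊆remove₂ r Tr)
    T⊆C : ∀ r → lookup T r ≡ true → lookup C r ≡ true
    T⊆C r Tr = proj₁ (∧-true (inRemove₂ r Tr))
    ∉T : ∀ r → (r == u) ≡ true ⊎ (r == v) ≡ true → lookup T r ≡ false
    ∉T r r∈uv with lookup T r in Tr
    ... | false = refl
    ... | true with ∧-true {lookup C r} (inRemove₂ r Tr) | r∈uv
    ... | _ , r≢u∧r≢v | inj₁ r==u = ⊥-elim (true≢false (trans (sym r≢u∧r≢v) (cong (λ b → not b ∧ not (r == v)) r==u)))
    ... | _ , r≢u∧r≢v | inj₂ r==v = ⊥-elim (true≢false (trans (sym r≢u∧r≢v) (trans (cong (λ b → not (r == u) ∧ not b) r==v) (Bool.∧-zeroʳ _))))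
    ⇒∈-⊻ : ∀ r → lookup C r ≡ true → lookup T r ≡ false → lookup (C ⊻ T) r ≡ true
    ⇒∈-⊻ r Cr Tr = trans (lookup-⊻ C T r) (cong₂ _xor_ Cr Tr)

  count-lifts : ∀ k u v C → 3 ≤ k → u ≢ v → Z.isZeroSumBlock k u v C ≡ true → ΣSubset N (𝟙 ∘ lifts u v C) ≡ 2 ^ (k ∸ 3)
  count-lifts (suc (suc (suc j))) u v C (s≤s (s≤s (s≤s _))) u≢v h
    with ∧-true {nonzeroᵇ C} h
  ... | _ , h₁ with ∧-true {∣ C ∣ ≡ᵇ suc (suc (suc j))} h₁
  ... | size , h₂ with ∧-true {B₀.Σᴮ C == B₀.0ᴮ} h₂
  ... | _ , members with ∧-true {lookup C u} members
  ... | Cu , Cv = paritySubsets-half (remove₂ u v C) false j (ℕ.suc-injective (ℕ.suc-injective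
    (trans (ℕ.+-comm 2 _) (trans (sym (∣remove₂∣ u v C u≢v Cu Cv)) (≡ᵇ-true⇒≡ size)))))

  ΣSubset-glue : (f : Subset (2 ^ suc n) → ℕ) → ΣSubset (2 ^ suc n) f ≡ ΣSubset N (λ S₀ → ΣSubset N (λ S₁ → f (glue S₀ S₁)))
  ΣSubset-glue f = trans (ΣSubset-++ N (N + 0) f) (ΣSubset-cong N (λ S₀ →
    trans (ΣSubset-++ N 0 (λ S → f (S₀ ++ S))) (ΣSubset-cong N (λ S₁ → ℕ.+-identityʳ _))))

  -- A block S is split by its e₀-coordinate into S₀ and S₁; then C = S₀ ⊻ S₁ is its image in Bits n and T = S₁.
  count-isBlock-e₀ : ∀ k u v → 3 ≤ k → u ≢ v →
    ΣSubset (2 ^ suc n) (𝟙 ∘ Blocks.isBlock (Bits (suc n)) k e₀ ⟨ false , u ⟩ ⟨ false , v ⟩)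
      ≡ 2 ^ (k ∸ 3) * ΣSubset N (𝟙 ∘ Z.isZeroSumBlock k u v)
  count-isBlock-e₀ k u v 3≤k u≢v = begin
    ΣSubset (2 ^ suc n) (𝟙 ∘ Blocks.isBlock (Bits (suc n)) k e₀ ⟨ false , u ⟩ ⟨ false , v ⟩)
      ≡⟨ ΣSubset-glue _ ⟩
    ΣSubset N (λ S₀ → ΣSubset N (λ S₁ → 𝟙 (Blocks.isBlock (Bits (suc n)) k e₀ ⟨ false , u ⟩ ⟨ false , v ⟩ (glue S₀ S₁))))
      ≡⟨ ΣSubset-cong N (λ S₀ → ΣSubset-cong N (λ S₁ → cong 𝟙 (isBlock-glue k u v S₀ S₁))) ⟩
    ΣSubset N (λ S₀ → ΣSubset N (λ S₁ → 𝟙 (isSplitBlock k u v S₀ S₁)))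
      ≡⟨ ΣSubset²-shear N _ ⟩
    ΣSubset N (λ C → ΣSubset N (λ T → 𝟙 (isSplitBlock k u v (C ⊻ T) T)))
      ≡⟨ ΣSubset-cong N (λ C → ΣSubset-cong N (λ T → trans (cong 𝟙 (Bool.⇔→≡ {z = true} (mk⇔ (isSplitBlock-shear⇒ k u v C T) (isSplitBlock-shear⇐ k u v C T))))
                                                         (𝟙-∧ (Z.isZeroSumBlock k u v C) _))) ⟩
    ΣSubset N (λ C → ΣSubset N (λ T → 𝟙 (Z.isZeroSumBlock k u v C) * 𝟙 (lifts u v C T)))
      ≡⟨ ΣSubset-cong N (λ C → Σℕ-* (𝟙 (Z.isZeroSumBlock k u v C)) _ (allSubsets N)) ⟩
    ΣSubset N (λ C → 𝟙 (Z.isZeroSumBlock k u v C) * ΣSubset N (𝟙 ∘ lifts u v C))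
      ≡⟨ ΣSubset-cong N liftsPerBlock ⟩
    ΣSubset N (λ C → 2 ^ (k ∸ 3) * 𝟙 (Z.isZeroSumBlock k u v C))
      ≡⟨ Σℕ-* (2 ^ (k ∸ 3)) _ (allSubsets N) ⟩
    2 ^ (k ∸ 3) * ΣSubset N (𝟙 ∘ Z.isZeroSumBlock k u v) ∎
    where
    open ≡-Reasoning
    liftsPerBlock : ∀ C → 𝟙 (Z.isZeroSumBlock k u v C) * ΣSubset N (𝟙 ∘ lifts u v C) ≡ 2 ^ (k ∸ 3) * 𝟙 (Z.isZeroSumBlock k u v C)
    liftsPerBlock C with Z.isZeroSumBlock k u v C in h
    ... | true  = trans (ℕ.+-identityʳ _) (trans (count-lifts k u v C 3≤k u≢v h) (sym (ℕ.*-identityʳ _)))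
    ... | false = sym (ℕ.*-zeroʳ (2 ^ (k ∸ 3)))

∈⇒lookup : ∀ {n} {x : Fin n} {S : Subset n} → x ∈ S → lookup S x ≡ true
∈⇒lookup = Vec.[]=⇒lookup

lookup⇒∈ : ∀ {n} {x : Fin n} {S : Subset n} → lookup S x ≡ true → x ∈ S
lookup⇒∈ {x = x} {S} = Vec.lookup⇒[]= x S

⌊∈?⌋≡lookup : ∀ {n} (x : Fin n) (S : Subset n) → ⌊ x ∈? S ⌋ ≡ lookup S x
⌊∈?⌋≡lookup x S = does-reflects (x ∈? S) (lookup S x) ∈⇒lookup lookup⇒∈

countSubsets≡ΣSubset𝟙 : ∀ {n} {P : Pred (Subset n) 0ℓ} (P? : Decidable P) (p : Subset n → Bool) →
  (∀ S → P S → p S ≡ true) → (∀ S → p S ≡ true → P S) → countSubsets P? ≡ ΣSubset n (𝟙 ∘ p)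
countSubsets≡ΣSubset𝟙 {n} P? p sound complete =
  trans (countSubsets≡ΣSubset P?) (ΣSubset-cong n (λ S → cong 𝟙 (does-reflects (P? S) (p S) (sound S) (complete S))))

≡∅⇒lookup : ∀ {n} (S : Subset n) → S ≡ ∅ → ∀ z → lookup S z ≡ false
≡∅⇒lookup S refl z = Vec.lookup-replicate z false

lookup⇒≡∅ : ∀ {n} (S : Subset n) → (∀ z → lookup S z ≡ false) → S ≡ ∅
lookup⇒≡∅ []      h = refl
lookup⇒≡∅ (s ∷ S) h = cong₂ _∷_ (h zero) (lookup⇒≡∅ S (h ∘ suc))

lookup-∩ : ∀ {n} (S T : Subset n) z → lookup (S ∩ T) z ≡ (lookup S z ∧ lookup T z)
lookup-∩ S T z = Vec.lookup-zipWith _∧_ z S T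

⊆⇒⊆ᵇ : ∀ {n} (S V : Subset n) → S ⊆ V → ∀ z → (not (lookup S z) ∨ lookup V z) ≡ true
⊆⇒⊆ᵇ S V S⊆V z = implies-∨ (∈⇒lookup ∘ S⊆V ∘ lookup⇒∈)

⊆ᵇ⇒⊆ : ∀ {n} (S V : Subset n) → (∀ z → (not (lookup S z) ∨ lookup V z) ≡ true) → S ⊆ V
⊆ᵇ⇒⊆ S V h {z} z∈S = lookup⇒∈ (∨-implies (h z) (∈⇒lookup z∈S))

module Reflection {q n : ℕ} (F : FieldOn q) (order : q ≡ 2 ^ suc n) where
  open FieldOn F using (0#) renaming (_+_ to _⊞_)
  open Construction F

  G : BooleanGroup q
  G = additiveBooleanGroup {n = n} F order

  open BooleanGroup G using (identityˡ)
  open Blocks G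

  sumOf≡Σᴮ : ∀ S → sumOf S ≡ BooleanGroup.Σᴮ G S
  sumOf≡Σᴮ S = go (allFin q)
    where
    go : ∀ xs → foldr (λ x acc → if ⌊ x ∈? S ⌋ then x ⊞ acc else acc) 0# xs ≡ foldr _⊞_ 0# (map (λ x → if lookup S x then x else 0#) xs)
    go []       = refl
    go (x ∷ xs) rewrite ⌊∈?⌋≡lookup x S with lookup S x
    ... | true  = cong (x ⊞_) (go xs)
    ... | false = trans (go xs) (sym (identityˡ _))

  lookup-Vα : ∀ α z → lookup (Vα α) z ≡ (not (z == 0#) ∧ not (z == α))
  lookup-Vα α z rewrite Vec.lookup∘tabulate (λ x → if ⌊ x ≟ 0# ⌋ then outside else if ⌊ x ≟ α ⌋ then outside else inside) z
    with z ≟ 0# | z ≟ α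
  ... | yes _ | _     = refl
  ... | no _  | yes _ = refl
  ... | no _  | no _  = refl

  lookup-nonzero : ∀ z → lookup nonzero z ≡ not (z == 0#)
  lookup-nonzero z rewrite Vec.lookup∘tabulate (λ x → if ⌊ x ≟ 0# ⌋ then outside else inside) z with z ≟ 0#
  ... | yes _ = refl
  ... | no _  = refl

  lookup-translate : ∀ S α z → lookup (translate S α) z ≡ lookup S (z ⊞ α)
  lookup-translate S α z = trans (Vec.lookup∘tabulate _ z) (cong (λ w → lookup S (z ⊞ w)) (CharacteristicTwo.-x≡x {n = n} F order α))

  private
    avoid⇒ : ∀ s a b t → (not s ∨ (a ∧ b)) ≡ true → (s ∧ t) ≡ false → (not s ∨ (a ∧ b ∧ not t)) ≡ true
    avoid⇒ false a     b     t     _  _  = refl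
    avoid⇒ true  true  true  false _  _  = refl
    avoid⇒ true  true  true  true  _  ()
    avoid⇒ true  true  false t     () _
    avoid⇒ true  false b     t     () _

    ⇒avoid : ∀ s a b t → (not s ∨ (a ∧ b ∧ not t)) ≡ true → (not s ∨ (a ∧ b)) ≡ true × (s ∧ t) ≡ false
    ⇒avoid false a     b     t     _  = refl , refl
    ⇒avoid true  true  true  false _  = refl , refl
    ⇒avoid true  true  true  true  ()
    ⇒avoid true  true  false t     ()
    ⇒avoid true  false b     t     ()

  isBlock-sound : ∀ k α x y S → Uk k α S × x ∈ S × y ∈ S → isBlock k α x y S ≡ true
  isBlock-sound k α x y S ((S⊆Vα , size , sum , disjoint) , x∈S , y∈S) =
    ∧-intro (⇒allᵇ-true _ pointwise)
    (∧-intro (subst (λ s → (s ≡ᵇ k) ≡ true) (sym size) (≡ᵇ-refl k))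
    (∧-intro (subst (λ s → (s == α) ≡ true) (trans (sym sum) (sumOf≡Σᴮ S)) (==-refl α))
    (∧-intro (∈⇒lookup x∈S) (∈⇒lookup y∈S))))
    where
    pointwise : ∀ z → (not (lookup S z) ∨ (not (z == 0#) ∧ not (z == α) ∧ not (lookup S (z ⊞ α)))) ≡ true
    pointwise z = avoid⇒ (lookup S z) (not (z == 0#)) (not (z == α)) (lookup S (z ⊞ α))
      (subst (λ w → (not (lookup S z) ∨ w) ≡ true) (lookup-Vα α z) (⊆⇒⊆ᵇ S (Vα α) S⊆Vα z))
      (trans (cong (lookup S z ∧_) (sym (lookup-translate S α z))) (trans (sym (lookup-∩ S (translate S α) z)) (≡∅⇒lookup _ disjoint z)))

  isBlock-complete : ∀ k α x y S → isBlock k α x y S ≡ true → Uk k α S × x ∈ S × y ∈ S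
  isBlock-complete k α x y S h
    with ∧-true {allᵇ (λ z → not (lookup S z) ∨ (not (z == 0#) ∧ not (z == α) ∧ not (lookup S (z ⊞ α))))} h
  ... | avoiding , h₁ with ∧-true {∣ S ∣ ≡ᵇ k} h₁
  ... | size , h₂ with ∧-true {BooleanGroup.Σᴮ G S == α} h₂
  ... | sum , members with ∧-true {lookup S x} members
  ... | Sx , Sy =
    ( ⊆ᵇ⇒⊆ S (Vα α) (λ z → subst (λ w → (not (lookup S z) ∨ w) ≡ true) (sym (lookup-Vα α z)) (proj₁ (pointwise z)))
    , ≡ᵇ-true⇒≡ size
    , trans (sumOf≡Σᴮ S) (==⇒≡ sum)
    , lookup⇒≡∅ _ (λ z → trans (lookup-∩ S (translate S α) z) (trans (cong (lookup S z ∧_) (lookup-translate S α z)) (proj₂ (pointwise z)))))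
    , lookup⇒∈ Sx , lookup⇒∈ Sy
    where
    pointwise : ∀ z → (not (lookup S z) ∨ (not (z == 0#) ∧ not (z == α))) ≡ true × (lookup S z ∧ lookup S (z ⊞ α)) ≡ false
    pointwise z = ⇒avoid (lookup S z) (not (z == 0#)) (not (z == α)) (lookup S (z ⊞ α)) (allᵇ-true⇒ _ avoiding z)

  isZeroSumBlock-sound : ∀ k a b S → ZeroSumK k S × a ∈ S × b ∈ S → isZeroSumBlock k a b S ≡ true
  isZeroSumBlock-sound k a b S ((S⊆nonzero , size , sum) , a∈S , b∈S) =
    ∧-intro (⇒allᵇ-true _ (λ z → subst (λ w → (not (lookup S z) ∨ w) ≡ true) (lookup-nonzero z) (⊆⇒⊆ᵇ S nonzero S⊆nonzero z)))
    (∧-intro (subst (λ s → (s ≡ᵇ k) ≡ true) (sym size) (≡ᵇ-refl k))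
    (∧-intro (subst (λ s → (s == 0#) ≡ true) (trans (sym sum) (sumOf≡Σᴮ S)) (==-refl 0#))
    (∧-intro (∈⇒lookup a∈S) (∈⇒lookup b∈S))))

  isZeroSumBlock-complete : ∀ k a b S → isZeroSumBlock k a b S ≡ true → ZeroSumK k S × a ∈ S × b ∈ S
  isZeroSumBlock-complete k a b S h
    with ∧-true {allᵇ (λ z → not (lookup S z) ∨ not (z == 0#))} h
  ... | avoiding , h₁ with ∧-true {∣ S ∣ ≡ᵇ k} h₁
  ... | size , h₂ with ∧-true {BooleanGroup.Σᴮ G S == 0#} h₂
  ... | sum , members with ∧-true {lookup S a} members
  ... | Sa , Sb =
    ( ⊆ᵇ⇒⊆ S nonzero (λ z → subst (λ w → (not (lookup S z) ∨ w) ≡ true) (sym (lookup-nonzero z)) (allᵇ-true⇒ _ avoiding z))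
    , ≡ᵇ-true⇒≡ size
    , trans (sumOf≡Σᴮ S) (==⇒≡ sum))
    , lookup⇒∈ Sa , lookup⇒∈ Sb

  blocksThrough≡ΣSubset : ∀ k α x y → blocksThrough (Uk? k α) x y ≡ ΣSubset q (𝟙 ∘ isBlock k α x y)
  blocksThrough≡ΣSubset k α x y = countSubsets≡ΣSubset𝟙 _ (isBlock k α x y) (isBlock-sound k α x y) (isBlock-complete k α x y)

  lambdaK≡ΣSubset : ∀ k a b → lambdaK k a b ≡ ΣSubset q (𝟙 ∘ isZeroSumBlock k a b)
  lambdaK≡ΣSubset k a b = countSubsets≡ΣSubset𝟙 _ (isZeroSumBlock k a b) (isZeroSumBlock-sound k a b) (isZeroSumBlock-complete k a b)

  ∈nonzero⇒≢0 : ∀ x → x ∈ nonzero → x ≢ 0#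
  ∈nonzero⇒≢0 x x∈ x≡0 = true≢false (trans (sym (∈⇒lookup x∈))
    (trans (lookup-nonzero x) (cong not (subst (λ z → (x == z) ≡ true) x≡0 (==-refl x)))))

module _ {A : Set} {_∙_ : Op₂ A} {ε : A} (isCM : IsCommutativeMonoid _≡_ _∙_ ε) where
  open MonoidSum isCM
  open IsCommutativeMonoid isCM using (identityˡ; identityʳ)

  sum-delta : ∀ n (c : Fin n) (g : Fin n → A) → sum (λ w → if w == c then g w else ε) (allFin n) ≡ g c
  sum-delta (suc n) zero g = trans (sum-allFin-suc {n} _) (trans (cong (g zero ∙_)
    (trans (sum-cong (allFin n) (λ _ → refl)) (sum-ε (allFin n)))) (identityʳ _))
  sum-delta (suc n) (suc c) g = trans (sum-allFin-suc {n} _) (trans (identityˡ _)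
    (trans (sum-cong (allFin n) (λ {w} _ → cong (λ b → if b then g (suc w) else ε) (==-injective suc suc-injective w c)))
    (sum-delta n c (g ∘ suc))))

Σℕ≢0⇒ : {A : Set} (f : A → ℕ) (xs : List A) → Σℕ f xs ≢ 0 → ∃ λ w → f w ≢ 0
Σℕ≢0⇒ f []       Σ≢0 = ⊥-elim (Σ≢0 refl)
Σℕ≢0⇒ f (x ∷ xs) Σ≢0 with f x ℕ.≟ 0
... | no  fx≢0 = x , fx≢0
... | yes fx≡0 = Σℕ≢0⇒ f xs (λ e → Σ≢0 (trans (cong (_+ Σℕ f xs) fx≡0) e))

Σℕ≡0⇒ : {A : Set} (f : A → ℕ) (xs : List A) → Σℕ f xs ≡ 0 → ∀ {w} → w ∈ₗ xs → f w ≡ 0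
Σℕ≡0⇒ f (x ∷ xs) e (here refl) = ℕ.m+n≡0⇒m≡0 (f x) e
Σℕ≡0⇒ f (x ∷ xs) e (there w∈) = Σℕ≡0⇒ f xs (ℕ.m+n≡0⇒n≡0 (f x) e) w∈

𝟙≢0⇒ : ∀ {b} → 𝟙 b ≢ 0 → b ≡ true
𝟙≢0⇒ {true}  _   = refl
𝟙≢0⇒ {false} ≢0 = ⊥-elim (≢0 refl)

pair : ∀ {n} → Fin n → Fin n → Subset n
pair x z = tabulate (λ w → (w == x) ∨ (w == z))

lookup-pair : ∀ {n} (x z w : Fin n) → lookup (pair x z) w ≡ ((w == x) ∨ (w == z))
lookup-pair x z w = Vec.lookup∘tabulate _ w

∈-pairˡ : ∀ {n} (x z : Fin n) → x ∈ pair x z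
∈-pairˡ x z = lookup⇒∈ (trans (lookup-pair x z x) (cong (_∨ (x == z)) (==-refl x)))

∈-pairʳ : ∀ {n} (x z : Fin n) → z ∈ pair x z
∈-pairʳ x z = lookup⇒∈ (trans (lookup-pair x z z) (trans (cong ((z == x) ∨_) (==-refl z)) (Bool.∨-zeroʳ _)))

∈-pair⇒ : ∀ {n} (x z w : Fin n) → w ∈ pair x z → w ≡ x ⊎ w ≡ z
∈-pair⇒ x z w w∈ with w ≟ x | w ≟ z | trans (sym (∈⇒lookup w∈)) (lookup-pair x z w)
... | yes w≡x | _       | _  = inj₁ w≡x
... | no _    | yes w≡z | _  = inj₂ w≡z
... | no _    | no _    | ()

𝟙-pair : ∀ {n} (x z w : Fin n) → x ≢ z → 𝟙 (lookup (pair x z) w) ≡ 𝟙 (w == x) + 𝟙 (w == z)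
𝟙-pair x z w x≢z rewrite lookup-pair x z w with w ≟ x | w ≟ z
... | yes refl | yes refl = ⊥-elim (x≢z refl)
... | yes _    | no _     = refl
... | no _     | yes _    = refl
... | no _     | no _     = refl

∣pair∣ : ∀ {n} (x z : Fin n) → x ≢ z → ∣ pair x z ∣ ≡ 2
∣pair∣ {n} x z x≢z = trans (∣∣≡Σ𝟙 (pair x z)) (trans (Σℕ-cong (allFin n) (λ {w} _ → 𝟙-pair x z w x≢z))
  (trans (Σℕ-+ _ _ (allFin n)) (cong₂ _+_ (Σℕ-𝟙≟ n x) (Σℕ-𝟙≟ n z))))

1≢0 : 1 ≢ 0
1≢0 ()

∣pair-x-x∣ : ∀ {n} (x : Fin n) → ∣ pair x x ∣ ≡ 1
∣pair-x-x∣ {n} x = trans (∣∣≡Σ𝟙 (pair x x)) (trans (Σℕ-cong (allFin n) (λ {w} _ → cong 𝟙 (trans (lookup-pair x x w) (Bool.∨-idem _))))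
  (Σℕ-𝟙≟ n x))

lookup-ext : ∀ {n} (S T : Subset n) → (∀ w → lookup S w ≡ lookup T w) → S ≡ T
lookup-ext S T h = trans (sym (Vec.tabulate∘lookup S)) (trans (Vec.tabulate-cong h) (Vec.tabulate∘lookup T))

_⊆ᵛ_ : ∀ {n} → Subset n → Subset n → Set
D ⊆ᵛ S = ∀ w → lookup D w ≡ true → lookup S w ≡ true

∣∣≡∣⊆∣+rest : ∀ {n} (D S : Subset n) → D ⊆ᵛ S →
  ∣ S ∣ ≡ ∣ D ∣ + Σℕ (λ w → 𝟙 (lookup S w ∧ not (lookup D w))) (allFin n)
∣∣≡∣⊆∣+rest {n} D S D⊆S = trans (∣∣≡Σ𝟙 S) (trans (Σℕ-cong (allFin n) (λ {w} _ → pointwise w))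
  (trans (Σℕ-+ _ _ (allFin n)) (cong (_+ Σℕ (λ w → 𝟙 (lookup S w ∧ not (lookup D w))) (allFin n)) (sym (∣∣≡Σ𝟙 D)))))
  where
  pointwise : ∀ w → 𝟙 (lookup S w) ≡ 𝟙 (lookup D w) + 𝟙 (lookup S w ∧ not (lookup D w))
  pointwise w with lookup D w in Dw | lookup S w in Sw
  ... | true  | true  = refl
  ... | true  | false = ⊥-elim (true≢false (trans (sym (D⊆S w Dw)) Sw))
  ... | false | true  = refl
  ... | false | false = refl

⊆∧∣∣≡⇒≡ : ∀ {n} (D S : Subset n) → D ⊆ᵛ S → ∣ S ∣ ≡ ∣ D ∣ → S ≡ D
⊆∧∣∣≡⇒≡ {n} D S D⊆S ∣S∣≡∣D∣ = lookup-ext S D pointwise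
  where
  rest≡0 : Σℕ (λ w → 𝟙 (lookup S w ∧ not (lookup D w))) (allFin n) ≡ 0
  rest≡0 = ℕ.+-cancelˡ-≡ ∣ D ∣ _ 0 (trans (sym (∣∣≡∣⊆∣+rest D S D⊆S)) (trans ∣S∣≡∣D∣ (sym (ℕ.+-identityʳ _))))
  pointwise : ∀ w → lookup S w ≡ lookup D w
  pointwise w with lookup D w in Dw
  ... | true  = D⊆S w Dw
  ... | false with lookup S w in Sw | Σℕ≡0⇒ _ (allFin n) rest≡0 (∈-allFin w)
  ...   | false | _  = refl
  ...   | true  | e rewrite Dw = ⊥-elim (1≢0 e)

∣⊆∣<∣∣⇒∃ : ∀ {n} (D S : Subset n) → D ⊆ᵛ S → suc ∣ D ∣ ≡ ∣ S ∣ → ∃ λ w → (lookup S w ∧ not (lookup D w)) ≡ true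
∣⊆∣<∣∣⇒∃ {n} D S D⊆S 1+∣D∣≡∣S∣ with Σℕ≢0⇒ _ (allFin n) rest≢0
  where
  rest≢0 : Σℕ (λ w → 𝟙 (lookup S w ∧ not (lookup D w))) (allFin n) ≢ 0
  rest≢0 rest≡0 = ℕ.1+n≢n (trans 1+∣D∣≡∣S∣ (trans (∣∣≡∣⊆∣+rest D S D⊆S) (trans (cong (∣ D ∣ +_) rest≡0) (ℕ.+-identityʳ _))))
... | w , 𝟙≢0 = w , 𝟙≢0⇒ 𝟙≢0

pair⊆ᵛ : ∀ {n} (S : Subset n) x z → lookup S x ≡ true → lookup S z ≡ true → pair x z ⊆ᵛ S
pair⊆ᵛ S x z Sx Sz w h with ∈-pair⇒ x z w (lookup⇒∈ h)
... | inj₁ refl = Sx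
... | inj₂ refl = Sz

∣∣≡2⇒pair : ∀ {n} (S : Subset n) x → ∣ S ∣ ≡ 2 → x ∈ S → ∃ λ z → z ≢ x × S ≡ pair x z
∣∣≡2⇒pair {n} S x ∣S∣≡2 x∈S
  with ∣⊆∣<∣∣⇒∃ (pair x x) S (pair⊆ᵛ S x x (∈⇒lookup x∈S) (∈⇒lookup x∈S)) (trans (cong suc (∣pair-x-x∣ x)) (sym ∣S∣≡2))
... | z , Sz∧z≢x = z , z≢x , ⊆∧∣∣≡⇒≡ (pair x z) S (pair⊆ᵛ S x z (∈⇒lookup x∈S) (proj₁ (∧-true Sz∧z≢x)))
                             (trans ∣S∣≡2 (sym (∣pair∣ x z (z≢x ∘ sym))))
  where
  z≢x : z ≢ x
  z≢x z≡x = true≢false (trans (sym Sz∧z≢x)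
    (trans (cong (λ b → lookup S z ∧ not b) (∈⇒lookup (subst (_∈ pair x x) (sym z≡x) (∈-pairˡ x x)))) (Bool.∧-zeroʳ _)))

module GroupStructure {q n : ℕ} (F : FieldOn q) (order : q ≡ 2 ^ suc n) (α : Fin q) (α≢0 : α ≢ FieldOn.0# F) where
  open FieldOn F using (0#)
  open Construction F
  open Reflection {n = n} F order
  open BooleanGroup G

  Σᴮ-pair : ∀ x z → x ≢ z → Σᴮ (pair x z) ≡ x ⊕ z
  Σᴮ-pair x z x≢z = trans (sum-cong (allFin q) (λ {w} _ → pointwise w))
    (trans (sum-distrib _ _ (allFin q)) (cong₂ _⊕_ (sum-delta isCommutativeMonoid q x (λ w → w)) (sum-delta isCommutativeMonoid q z (λ w → w))))
    where
    pointwise : ∀ w → (if lookup (pair x z) w then w else 0ᴮ) ≡ (if w == x then w else 0ᴮ) ⊕ (if w == z then w else 0ᴮ)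
    pointwise w rewrite lookup-pair x z w with w ≟ x | w ≟ z
    ... | yes refl | yes refl = ⊥-elim (x≢z refl)
    ... | yes _    | no _     = sym (identityʳ w)
    ... | no _     | yes _    = sym (identityˡ w)
    ... | no _     | no _     = sym (identityˡ 0ᴮ)

  ∈Vα⇒ : ∀ x → x ∈ Vα α → x ≢ 0# × x ≢ α
  ∈Vα⇒ x x∈ with x ≟ 0# | x ≟ α | trans (sym (∈⇒lookup x∈)) (lookup-Vα α x)
  ... | no x≢0 | no x≢α | _  = x≢0 , x≢α
  ... | yes _  | _      | ()
  ... | no _   | yes _  | ()

  ⇒∈Vα : ∀ x → x ≢ 0# → x ≢ α → x ∈ Vα α
  ⇒∈Vα x x≢0 x≢α with x ≟ 0# | x ≟ α | lookup-Vα α x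
  ... | no _     | no _     | e = lookup⇒∈ e
  ... | yes x≡0  | _        | _ = ⊥-elim (x≢0 x≡0)
  ... | no _     | yes x≡α  | _ = ⊥-elim (x≢α x≡α)

  group : Fin q → Subset q
  group x = pair x (x ⊕ α)

  x≢x⊕α : ∀ x → x ≢ x ⊕ α
  x≢x⊕α x e = α≢0 (sym (⊕-cancelˡ x 0ᴮ α (trans (identityʳ x) e)))

  group-∈U2 : ∀ x → x ∈ Vα α → U2 α (group x)
  group-∈U2 x x∈Vα = group⊆Vα , ∣pair∣ x (x ⊕ α) (x≢x⊕α x) , trans (sumOf≡Σᴮ _) (trans (Σᴮ-pair x (x ⊕ α) (x≢x⊕α x)) (x⊕[x⊕y]≡y x α))
    where
    group⊆Vα : group x ⊆ Vα α
    group⊆Vα {w} w∈ with ∈-pair⇒ x (x ⊕ α) w w∈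
    ... | inj₁ refl = x∈Vα
    ... | inj₂ refl = ⇒∈Vα (x ⊕ α) (proj₂ (∈Vα⇒ x x∈Vα) ∘ x⊕y≡0ᴮ⇒x≡y x α)
      (λ e → proj₁ (∈Vα⇒ x x∈Vα) (⊕-cancelˡ α x 0ᴮ (trans (comm α x) (trans e (sym (identityʳ α))))))

  U2⇒≡group : ∀ S x → U2 α S → x ∈ S → S ≡ group x
  U2⇒≡group S x (_ , ∣S∣≡2 , sum) x∈S with ∣∣≡2⇒pair S x ∣S∣≡2 x∈S
  ... | z , z≢x , S≡xz = trans S≡xz (cong (pair x) z≡x⊕α)
    where
    z≡x⊕α : z ≡ x ⊕ α
    z≡x⊕α = trans (sym (x⊕[x⊕y]≡y x z)) (cong (x ⊕_)
      (trans (sym (Σᴮ-pair x z (z≢x ∘ sym))) (trans (cong Σᴮ (sym S≡xz)) (trans (sym (sumOf≡Σᴮ S)) sum))))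

  U2-nonempty : ∀ S → U2 α S → ∃ λ x → x ∈ S
  U2-nonempty S (_ , ∣S∣≡2 , _) with Σℕ≢0⇒ (𝟙 ∘ lookup S) (allFin q) (λ e → 2≢0 (trans (sym ∣S∣≡2) (trans (∣∣≡Σ𝟙 S) e)))
    where
    2≢0 : 2 ≢ 0
    2≢0 ()
  ... | x , Sx≢0 = x , lookup⇒∈ (𝟙≢0⇒ Sx≢0)

  no-block-through-group : ∀ k x y → x ⊕ y ≡ α → blocksThrough (Uk? k α) x y ≡ 0
  no-block-through-group k x y x⊕y≡α =
    trans (countSubsets≡ΣSubset𝟙 _ (λ _ → false) (λ S → ⊥-elim ∘ no-block S) (λ S ())) (Σℕ-0 (allSubsets q))
    where
    y≡x⊕α : y ≡ x ⊕ α
    y≡x⊕α = trans (sym (x⊕[x⊕y]≡y x y)) (cong (x ⊕_) x⊕y≡α)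
    no-block : ∀ S → Uk k α S × x ∈ S × y ∈ S → ⊥
    no-block S ((_ , _ , _ , disjoint) , x∈S , y∈S) = true≢false (begin
      true                              ≡⟨ cong₂ _∧_ (∈⇒lookup x∈S) (∈⇒lookup y∈S) ⟨
      lookup S x ∧ lookup S y           ≡⟨ cong (λ w → lookup S x ∧ lookup S w) y≡x⊕α ⟩
      lookup S x ∧ lookup S (x ⊕ α)     ≡⟨ cong (lookup S x ∧_) (lookup-translate S α x) ⟨
      lookup S x ∧ lookup (translate S α) x ≡⟨ lookup-∩ S (translate S α) x ⟨
      lookup (S ∩ translate S α) x      ≡⟨ ≡∅⇒lookup _ disjoint x ⟩
      false                             ∎)
      where open ≡-Reasoning

  pair-condition : ∀ k λ' → (∀ x y → x ∈ Vα α → y ∈ Vα α → x ≢ y → x ⊕ y ≢ α → blocksThrough (Uk? k α) x y ≡ λ') →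
    ∀ x y → x ∈ Vα α → y ∈ Vα α → x ≢ y →
      ((∃ λ S → U2 α S × x ∈ S × y ∈ S) × blocksThrough (Uk? k α) x y ≡ 0)
    ⊎ ((¬ ∃ λ S → U2 α S × x ∈ S × y ∈ S) × blocksThrough (Uk? k α) x y ≡ λ')
  pair-condition k λ' count x y x∈Vα y∈Vα x≢y with (x ⊕ y) ≟ α
  ... | yes x⊕y≡α = inj₁ ((group x , group-∈U2 x x∈Vα , ∈-pairˡ x (x ⊕ α) , y∈group) , no-block-through-group k x y x⊕y≡α)
    where
    y∈group : y ∈ group x
    y∈group = subst (_∈ group x) (trans (sym (cong (x ⊕_) x⊕y≡α)) (x⊕[x⊕y]≡y x y)) (∈-pairʳ x (x ⊕ α))
  ... | no x⊕y≢α = inj₂ (different-groups , count x y x∈Vα y∈Vα x≢y x⊕y≢α)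
    where
    different-groups : ¬ ∃ λ S → U2 α S × x ∈ S × y ∈ S
    different-groups (S , S∈U2 , x∈S , y∈S) with ∈-pair⇒ x (x ⊕ α) y (subst (y ∈_) (U2⇒≡group S x S∈U2 x∈S) y∈S)
    ... | inj₁ y≡x   = x≢y (sym y≡x)
    ... | inj₂ y≡x⊕α = x⊕y≢α (trans (cong (x ⊕_) y≡x⊕α) (x⊕[x⊕y]≡y x α))

module BlockCount (d : ℕ) (F : FieldOn (2 ^ (3 + d))) (F' : FieldOn (2 ^ (2 + d))) where
  private
    module R  = Reflection {n = 2 + d} F refl
    module R' = Reflection {n = 1 + d} F' refl
    module G  = BooleanGroup R.G
    module G' = BooleanGroup R'.G
    module LG  = Linear R.G
    module LG' = Linear R'.G
  open Halves (2 + d) using (⟨_,_⟩; e₀)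
  open Blocks (Bits (3 + d)) using (isBlock)
  open Blocks (Bits (2 + d)) using (isZeroSumBlock)

  u v : Fin (2 ^ (2 + d))
  u = fromBits (2 + d) (true ∷ false ∷ zeros d)
  v = fromBits (2 + d) (false ∷ true ∷ zeros d)

  u≢v : u ≢ v
  u≢v e with fromBits-injective (2 + d) {true ∷ false ∷ zeros d} {false ∷ true ∷ zeros d} e
  ... | ()

  from-lincomb : ∀ {j} {H : BooleanGroup (2 ^ (j + d))} (ws : Vec (Fin (2 ^ (j + d))) j) (I : Bits (j + d) ≅ H) →
    (∀ bs → _≅_.to I (fromBits (j + d) (bs ++ zeros d)) ≡ Linear.lincomb H ws bs) →
    ∀ bs {w} → Linear.lincomb H ws bs ≡ w → _≅_.from I w ≡ fromBits (j + d) (bs ++ zeros d)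
  from-lincomb ws I to-standard bs refl = trans (cong (_≅_.from I) (sym (to-standard bs))) (_≅_.from-to I _)

  module CoordinatesOfF {α x y : Fin (2 ^ (3 + d))} (α≢0 : α ≢ G.0ᴮ) (x≢0 : x ≢ G.0ᴮ) (y≢0 : y ≢ G.0ᴮ)
    (x≢α : x ≢ α) (y≢α : y ≢ α) (x≢y : x ≢ y) (x⊕y≢α : x G.⊕ y ≢ α) where

    independent : LG.Independent (α ∷ x ∷ y ∷ [])
    independent = LG.independent-∷ (x ∷ y ∷ []) α
      (LG.independent-∷ (y ∷ []) x (LG.independent-∷ [] y LG.independent-[] (LG.∉span₀ y y≢0)) (LG.∉span₁ y x x≢0 x≢y))
      (LG.∉span₂ x y α α≢0 (x≢α ∘ sym) (y≢α ∘ sym) (x⊕y≢α ∘ sym))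

    iso : Σ (Bits (3 + d) ≅ R.G) λ I → ∀ bs → _≅_.to I (fromBits (3 + d) (bs ++ zeros d)) ≡ LG.lincomb (α ∷ x ∷ y ∷ []) bs
    iso = Bits≅ 3 d R.G (α ∷ x ∷ y ∷ []) independent

    I : Bits (3 + d) ≅ R.G
    I = proj₁ iso

    from : Fin (2 ^ (3 + d)) → Fin (2 ^ (3 + d))
    from = _≅_.from I

    from-α : from α ≡ e₀
    from-α = from-lincomb (α ∷ x ∷ y ∷ []) I (proj₂ iso) (true ∷ false ∷ false ∷ [])
      (trans (cong (α G.⊕_) (trans (G.identityˡ _) (G.identityˡ _))) (G.identityʳ α))

    from-x : from x ≡ ⟨ false , u ⟩
    from-x = from-lincomb (α ∷ x ∷ y ∷ []) I (proj₂ iso) (false ∷ true ∷ false ∷ [])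
      (trans (G.identityˡ _) (trans (cong (x G.⊕_) (G.identityˡ _)) (G.identityʳ x)))

    from-y : from y ≡ ⟨ false , v ⟩
    from-y = from-lincomb (α ∷ x ∷ y ∷ []) I (proj₂ iso) (false ∷ false ∷ true ∷ [])
      (trans (G.identityˡ _) (trans (G.identityˡ _) (G.identityʳ y)))

    count-blocks : ∀ k → 3 ≤ k →
      blocksThrough (Construction.Uk? F k α) x y ≡ 2 ^ (k ∸ 3) * ΣSubset _ (𝟙 ∘ isZeroSumBlock k u v)
    count-blocks k 3≤k = begin
      blocksThrough (Construction.Uk? F k α) x y                ≡⟨ R.blocksThrough≡ΣSubset k α x y ⟩
      ΣSubset _ (𝟙 ∘ Blocks.isBlock R.G k α x y)                ≡⟨ Transport.count-isBlock I k α x y ⟩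
      ΣSubset _ (𝟙 ∘ isBlock k (from α) (from x) (from y))      ≡⟨ cong₂ (λ p q → ΣSubset _ (𝟙 ∘ isBlock k p (from x) q)) from-α from-y ⟩
      ΣSubset _ (𝟙 ∘ isBlock k e₀ (from x) ⟨ false , v ⟩)       ≡⟨ cong (λ p → ΣSubset _ (𝟙 ∘ isBlock k e₀ p ⟨ false , v ⟩)) from-x ⟩
      ΣSubset _ (𝟙 ∘ isBlock k e₀ ⟨ false , u ⟩ ⟨ false , v ⟩)   ≡⟨ LiftCount.count-isBlock-e₀ (2 + d) k u v 3≤k u≢v ⟩
      2 ^ (k ∸ 3) * ΣSubset _ (𝟙 ∘ isZeroSumBlock k u v)        ∎
      where open ≡-Reasoning

  module CoordinatesOfF' {a b : Fin (2 ^ (2 + d))} (a≢0 : a ≢ G'.0ᴮ) (b≢0 : b ≢ G'.0ᴮ) (a≢b : a ≢ b) where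

    independent : LG'.Independent (a ∷ b ∷ [])
    independent = LG'.independent-∷ (b ∷ []) a (LG'.independent-∷ [] b LG'.independent-[] (LG'.∉span₀ b b≢0)) (LG'.∉span₁ b a a≢0 a≢b)

    iso : Σ (Bits (2 + d) ≅ R'.G) λ I → ∀ bs → _≅_.to I (fromBits (2 + d) (bs ++ zeros d)) ≡ LG'.lincomb (a ∷ b ∷ []) bs
    iso = Bits≅ 2 d R'.G (a ∷ b ∷ []) independent

    I : Bits (2 + d) ≅ R'.G
    I = proj₁ iso

    from : Fin (2 ^ (2 + d)) → Fin (2 ^ (2 + d))
    from = _≅_.from I

    from-a : from a ≡ u
    from-a = from-lincomb (a ∷ b ∷ []) I (proj₂ iso) (true ∷ false ∷ []) (trans (cong (a G'.⊕_) (G'.identityˡ _)) (G'.identityʳ a))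

    from-b : from b ≡ v
    from-b = from-lincomb (a ∷ b ∷ []) I (proj₂ iso) (false ∷ true ∷ []) (trans (G'.identityˡ _) (G'.identityʳ b))

    count-zero-sum-blocks : ∀ k → Construction.lambdaK F' k a b ≡ ΣSubset _ (𝟙 ∘ isZeroSumBlock k u v)
    count-zero-sum-blocks k = begin
      Construction.lambdaK F' k a b                             ≡⟨ R'.lambdaK≡ΣSubset k a b ⟩
      ΣSubset _ (𝟙 ∘ Blocks.isZeroSumBlock R'.G k a b)          ≡⟨ Transport.count-isZeroSumBlock I k a b ⟩
      ΣSubset _ (𝟙 ∘ isZeroSumBlock k (from a) (from b))        ≡⟨ cong₂ (λ p q → ΣSubset _ (𝟙 ∘ isZeroSumBlock k p q)) from-a from-b ⟩
      ΣSubset _ (𝟙 ∘ isZeroSumBlock k u v)                      ∎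
      where open ≡-Reasoning

  count : ∀ k α x y a b → 3 ≤ k →
    α ≢ G.0ᴮ → x ≢ G.0ᴮ → y ≢ G.0ᴮ → x ≢ α → y ≢ α → x ≢ y → x G.⊕ y ≢ α →
    a ≢ G'.0ᴮ → b ≢ G'.0ᴮ → a ≢ b →
    blocksThrough (Construction.Uk? F k α) x y ≡ 2 ^ (k ∸ 3) * Construction.lambdaK F' k a b
  count k α x y a b 3≤k α≢0 x≢0 y≢0 x≢α y≢α x≢y x⊕y≢α a≢0 b≢0 a≢b =
    trans (CoordinatesOfF.count-blocks α≢0 x≢0 y≢0 x≢α y≢α x≢y x⊕y≢α k 3≤k)
      (cong (2 ^ (k ∸ 3) *_) (sym (CoordinatesOfF'.count-zero-sum-blocks a≢0 b≢0 a≢b k)))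

module _ {m : ℕ} (F : FieldOn (2 ^ suc m)) (α : Fin (2 ^ suc m)) (α≢0 : α ≢ FieldOn.0# F) where
  private
    G : BooleanGroup (2 ^ suc m)
    G = Reflection.G {n = m} F refl
  open BooleanGroup G
  open Linear G
  open Extension (suc m) G
  open GroupStructure {n = m} F refl α α≢0

  several-groups : 2 ≤ m → ∃ λ S → ∃ λ T → Construction.U2 F α S × Construction.U2 F α T × S ≢ T
  several-groups 2≤m with outside-span (α ∷ []) (s≤s (ℕ.≤-trans (ℕ.n≤1+n 1) 2≤m))
  ... | x , x∉⟨α⟩ with outside-span (x ∷ α ∷ []) (s≤s 2≤m)
  ... | y , y∉⟨x,α⟩ = group x , group y , group-∈U2 x x∈Vα , group-∈U2 y y∈Vα , group-x≢group-y
    where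
    x∈Vα : x ∈ Construction.Vα F α
    x∈Vα = ⇒∈Vα x (λ x≡0 → x∉⟨α⟩ (false ∷ []) (trans (identityˡ 0ᴮ) (sym x≡0)))
                   (λ x≡α → x∉⟨α⟩ (true ∷ []) (trans (identityʳ α) (sym x≡α)))
    y∉ : ∀ b c → scale b x ⊕ scale c α ≢ y
    y∉ b c e = y∉⟨x,α⟩ (b ∷ c ∷ []) (trans (lincomb₂ x α b c) e)
    y∈Vα : y ∈ Construction.Vα F α
    y∈Vα = ⇒∈Vα y (λ y≡0 → y∉ false false (trans (identityˡ 0ᴮ) (sym y≡0)))
                   (λ y≡α → y∉ false true (trans (identityˡ α) (sym y≡α)))
    group-x≢group-y : group x ≢ group y
    group-x≢group-y e with ∈-pair⇒ x (x ⊕ α) y (subst (y ∈_) (sym e) (∈-pairˡ y (y ⊕ α)))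
    ... | inj₁ y≡x   = y∉ true false (trans (identityʳ x) (sym y≡x))
    ... | inj₂ y≡x⊕α = y∉ true true (sym y≡x⊕α)

blocksThrough-count : ∀ m → 3 ≤ m → (F : FieldOn (2 ^ suc m)) (F' : FieldOn (2 ^ m)) →
  ∀ α → α ≢ FieldOn.0# F → ∀ k → 3 ≤ k →
  ∀ a b → a ∈ Construction.nonzero F' → b ∈ Construction.nonzero F' → a ≢ b →
  ∀ x y → x ∈ Construction.Vα F α → y ∈ Construction.Vα F α → x ≢ y → FieldOn._+_ F x y ≢ α →
  blocksThrough (Construction.Uk? F k α) x y ≡ 2 ^ (k ∸ 3) * Construction.lambdaK F' k a b
blocksThrough-count (suc (suc d)) (s≤s (s≤s _)) F F' α α≢0 k 3≤k a b a∈ b∈ a≢b x y x∈ y∈ x≢y x+y≢α =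
  BlockCount.count d F F' k α x y a b 3≤k α≢0 (proj₁ x∉) (proj₁ y∉) (proj₂ x∉) (proj₂ y∉) x≢y x+y≢α
    (∈nonzero⇒≢0 a a∈) (∈nonzero⇒≢0 b b∈) a≢b
  where
  open GroupStructure {n = suc (suc d)} F refl α α≢0 using (∈Vα⇒)
  open Reflection {n = suc d} F' refl using (∈nonzero⇒≢0)
  x∉ : x ≢ FieldOn.0# F × x ≢ α
  x∉ = ∈Vα⇒ x x∈
  y∉ : y ≢ FieldOn.0# F × y ≢ α
  y∉ = ∈Vα⇒ y y∈

theorem3p4 : (m : ℕ) → 3 ≤ m →
    (F : FieldOn (2 ^ suc m)) → (F' : FieldOn (2 ^ m)) →
    (α : Fin (2 ^ suc m)) → α ≢ FieldOn.0# F →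
    (k : ℕ) → 3 ≤ k → k ≤ 2 ^ m ∸ 4 →
    (a b : Fin (2 ^ m)) → a ∈ Construction.nonzero F' → b ∈ Construction.nonzero F' → a ≢ b →
    IsGDD k (2 ^ (k ∸ 3) * Construction.lambdaK F' k a b)
      (Construction.Vα F α) (Construction.U2 F α)
      (Construction.Uk F k α) (Construction.Uk? F k α)
theorem3p4 m 3≤m F F' α α≢0 k 3≤k _ a b a∈ b∈ a≢b = record
  { groups-⊆        = λ S → proj₁
  ; groups-nonempty = U2-nonempty
  ; groups-cover    = λ x x∈Vα → group x , group-∈U2 x x∈Vα , ∈-pairˡ x (x ⊕ α)
  ; groups-disjoint = λ S T x S∈U2 T∈U2 x∈S x∈T → trans (U2⇒≡group S x S∈U2 x∈S) (sym (U2⇒≡group T x T∈U2 x∈T))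
  ; blocks-⊆        = λ S → proj₁
  ; blocks-size     = λ S → proj₁ ∘ proj₂
  ; pairs           = pair-condition k _ (blocksThrough-count m 3≤m F F' α α≢0 k 3≤k a b a∈ b∈ a≢b)
  ; several-groups  = several-groups F α α≢0 (ℕ.≤-trans (ℕ.n≤1+n 2) 3≤m)
  }
  where
  open GroupStructure {n = m} F refl α α≢0
  open BooleanGroup (Reflection.G {n = m} F refl) using (_⊕_)
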